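{- Let $s$ be a degree sequence and let $U,U'\in\mathcal{U}(s)$. Then there exists a u-switch sequence transforming $U$ into $U'$; that is, there are 2-switches $\tau_1,\dots,\tau_k$ ($k\ge 0$) such that, with $U_0=U$ and $U_i=\tau_i(U_{i-1})$, each $\tau_i$ is a u-switch over $U_{i-1}$ and $U_k=U'$. In particular every intermediate graph $U_i$ is a unicyclic graph with degree sequence $s$.
   Context: All graphs are finite, simple, undirected and labeled, with vertex set $[n]=\{1,\dots,n\}$. The degree sequence of a graph $G$ with $V(G)=[n]$ is $s(G)=(d_1,\dots,d_n)$ where $d_i$ is the degree of vertex $i$; so two graphs have the same degree sequence iff every vertex has the same degree in both. A graph is unicyclic if it is connected and contains exactly one cycle; $\mathcal{U}(s)$ denotes the set of unicyclic graphs with degree sequence $s$. For $a,b,c,d\in[n]$, the matrix $A=\binom{a\ b}{c\ d}$ is interchangeable in $G$ if $ab,cd\in E(G)$, $\{a,b\}\cap\{c,d\}=\varnothing$ and $ac,bd\notin E(G)$. The 2-switch $\tau_A$ is the map sending $G$ to $G-ab-cd+ac+bd$ if $A$ is interchangeable in $G$, and to $G$ otherwise (in which case $\tau_A$ is trivial for $G$). A nontrivial 2-switch $\tau$ over a unicyclic graph $U$ is a u-switch if $\tau(U)$ is unicyclic. The empty sequence counts as a u-switch sequence. -}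

module Defs where

open import Data.Bool.Base using (Bool; T; not; _∧_; _∨_)
open import Data.Bool.Properties using (T?; T-∧; T-∨)
open import Data.Fin.Base using (Fin)
open import Data.Fin.Properties using (_≟_)
open import Data.Fin.Subset using (Subset; ∣_∣)
open import Data.List.Base using (List; []; _∷_; _∷ʳ_; zip; length; foldl)
open import Data.List.Membership.Propositional using (_∈_)
open import Data.List.Relation.Unary.All using (All)
open import Data.List.Scans.Base using (scanl)
open import Data.List.Relation.Unary.Unique.Propositional using (Unique)
open import Data.Nat.Base using (ℕ; _≤_)
open import Data.Product.Base using (Σ; _×_; _,_; proj₁; proj₂; swap)
open import Data.Sum.Base using (_⊎_; inj₁; inj₂; [_,_])
open import Data.Unit.Base using (⊤)
open import Data.Vec.Base using (Vec; tabulate)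
open import Function.Base using (_∘_)
open import Function.Bundles using (_⇔_; mk⇔; module Equivalence)
open import Level using (0ℓ)
open import Relation.Binary.Core using (Rel)
open import Relation.Binary.Construct.Closure.ReflexiveTransitive using (Star)
open import Relation.Binary.PropositionalEquality
  using (_≡_; _≢_; sym; trans; subst; cong₂)
open import Relation.Nullary.Decidable
  using (Dec; yes; no; does; dec-false; does-⇔; ¬?; _×-dec_; _⊎-dec_)
open import Relation.Nullary.Negation using (¬_)
open import Relation.Unary using (Pred)

record Graph (n : ℕ) : Set where
  field
    adj      : Fin n → Fin n → Bool
    adj-sym  : ∀ u v → adj u v ≡ adj v u
    loopless : ∀ u → ¬ T (adj u u)

open Graph public

Edge : ∀ {n} → Graph n → Rel (Fin n) 0ℓ
Edge G u v = T (adj G u v)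

-- Equality of labeled graphs: the same edges.  Propositional equality of
-- the records would also compare the functions and the proofs intensionally.
infix 4 _≈_
_≈_ : ∀ {n} → Rel (Graph n) 0ℓ
G ≈ H = ∀ u v → Edge G u v ⇔ Edge H u v

neighbours : ∀ {n} → Graph n → Fin n → Subset n
neighbours G v = tabulate (adj G v)

degree : ∀ {n} → Graph n → Fin n → ℕ
degree G v = ∣ neighbours G v ∣

degreeSequence : ∀ {n} → Graph n → Vec ℕ n
degreeSequence G = tabulate (degree G)

Connected : ∀ {n} → Graph n → Set
Connected G = ∀ u v → Star (Edge G) u v

-- The steps v₀v₁, v₁v₂, …, vₖ₋₁vₖ, vₖv₀ of the closed sequence v₀ v₁ … vₖ.
cyclicSteps : ∀ {n} → Fin n → List (Fin n) → List (Fin n × Fin n)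
cyclicSteps v vs = zip (v ∷ vs) (vs ∷ʳ v)

-- A cycle, presented by a starting vertex and a direction of traversal.
record Cycle {n} (G : Graph n) : Set where
  field
    start    : Fin n
    others   : List (Fin n)
    long     : 3 ≤ length (start ∷ others)
    distinct : Unique (start ∷ others)
    adjacent : All (λ (u , v) → Edge G u v) (cyclicSteps start others)

CycleEdge : ∀ {n} {G : Graph n} → Cycle G → Rel (Fin n) 0ℓ
CycleEdge C u v = (u , v) ∈ steps ⊎ (v , u) ∈ steps
  where steps = cyclicSteps (Cycle.start C) (Cycle.others C)

-- Two presentations give the same cycle (as a subgraph) when they have the
-- same edges, whatever the starting vertex and the direction.
SameCycle : ∀ {n} {G : Graph n} → Rel (Cycle G) 0ℓ
SameCycle C D = ∀ u v → CycleEdge C u v ⇔ CycleEdge D u v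

Unicyclic : ∀ {n} → Graph n → Set
Unicyclic G = Connected G × Σ (Cycle G) λ C → ∀ D → SameCycle C D

𝒰 : ∀ {n} → Vec ℕ n → Pred (Graph n) 0ℓ
𝒰 s G = Unicyclic G × degreeSequence G ≡ s

-- The unordered pairs {u,v} and {a,b} coincide.
SamePair : ∀ {n} → (a b u v : Fin n) → Set
SamePair a b u v = (u ≡ a × v ≡ b) ⊎ (u ≡ b × v ≡ a)

samePair? : ∀ {n} (a b u v : Fin n) → Dec (SamePair a b u v)
samePair? a b u v = ((u ≟ a) ×-dec (v ≟ b)) ⊎-dec ((u ≟ b) ×-dec (v ≟ a))

samePair-sym : ∀ {n} (a b u v : Fin n) →
               does (samePair? a b u v) ≡ does (samePair? a b v u)
samePair-sym a b u v =
  does-⇔ (mk⇔ flip flip) (samePair? a b u v) (samePair? a b v u)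
  where
  flip : ∀ {x y} → SamePair a b x y → SamePair a b y x
  flip = [ inj₂ ∘ swap , inj₁ ∘ swap ]

deleteEdge : ∀ {n} → Graph n → (a b : Fin n) → Graph n
deleteEdge G a b = record
  { adj      = λ u v → adj G u v ∧ not (does (samePair? a b u v))
  ; adj-sym  = λ u v → cong₂ (λ x y → x ∧ not y) (adj-sym G u v) (samePair-sym a b u v)
  ; loopless = λ u → loopless G u ∘ proj₁ ∘ Equivalence.to T-∧
  }

addEdge : ∀ {n} → Graph n → (a b : Fin n) → a ≢ b → Graph n
addEdge G a b a≢b = record
  { adj      = λ u v → adj G u v ∨ does (samePair? a b u v)
  ; adj-sym  = λ u v → cong₂ _∨_ (adj-sym G u v) (samePair-sym a b u v)
  ; loopless = λ u → [ loopless G u , notLoop u ] ∘ Equivalence.to T-∨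
  }
  where
  notLoop : ∀ u → ¬ T (does (samePair? a b u u))
  notLoop u = subst T (dec-false (samePair? a b u u) [ distinct , distinct ∘ swap ])
    where
    distinct : ¬ (u ≡ a × u ≡ b)
    distinct (u≡a , u≡b) = a≢b (trans (sym u≡a) u≡b)

-- The matrix with first row a b and second row c d.
record Matrix (n : ℕ) : Set where
  constructor matrix
  field
    a b c d : Fin n

Disjoint : ∀ {n} → (a b c d : Fin n) → Set
Disjoint a b c d = (a ≢ c × a ≢ d) × (b ≢ c × b ≢ d)

Interchangeable : ∀ {n} → Matrix n → Graph n → Set
Interchangeable (matrix a b c d) G =
  (Edge G a b × Edge G c d) × Disjoint a b c d × (¬ Edge G a c × ¬ Edge G b d)

interchangeable? : ∀ {n} (A : Matrix n) (G : Graph n) → Dec (Interchangeable A G)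
interchangeable? (matrix a b c d) G =
  (T? (adj G a b) ×-dec T? (adj G c d)) ×-dec
  ((¬? (a ≟ c) ×-dec ¬? (a ≟ d)) ×-dec (¬? (b ≟ c) ×-dec ¬? (b ≟ d))) ×-dec
  (¬? (T? (adj G a c)) ×-dec ¬? (T? (adj G b d)))

interchange : ∀ {n} (A : Matrix n) (G : Graph n) → Interchangeable A G → Graph n
interchange (matrix a b c d) G (_ , ((a≢c , _) , (_ , b≢d)) , _) =
  addEdge (addEdge (deleteEdge (deleteEdge G a b) c d) a c a≢c) b d b≢d

τ : ∀ {n} → Matrix n → Graph n → Graph n
τ A G with interchangeable? A G
... | yes i = interchange A G i
... | no  _ = G

-- Interchangeability says that τ A is nontrivial for U.
USwitch : ∀ {n} → Matrix n → Graph n → Set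
USwitch A U = Unicyclic U × Interchangeable A U × Unicyclic (τ A U)

USwitchSequence : ∀ {n} → List (Matrix n) → Graph n → Set
USwitchSequence []       U = ⊤
USwitchSequence (A ∷ As) U = USwitch A U × USwitchSequence As (τ A U)

result : ∀ {n} → List (Matrix n) → Graph n → Graph n
result As U = foldl (λ G A → τ A G) U As

-- All the graphs U₀, U₁, …, Uₖ, both ends included.
trajectory : ∀ {n} → List (Matrix n) → Graph n → List (Graph n)
trajectory As U = scanl (λ G A → τ A G) U As

{-# OPTIONS --safe #-}
module Submission where

-- Everything reduces to connected graphs: G on n vertices is unicyclic iff it
-- is connected with n edges, and 2-switches preserve degrees, hence the number
-- of edges.  So a nontrivial 2-switch over a unicyclic graph is a u-switch as
-- soon as its result is connected.
--
-- Let G and H be connected with the same degrees and at most n edges.  Some v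
-- is a cut vertex of neither: a leaf if there is one; otherwise both graphs are
-- 2-regular and any v will do.  If the neighbourhoods of v differ, take w
-- adjacent to v only in G and c only in H.  When deg w ≤ deg c, as in the
-- Havel–Hakimi theorem c has a neighbour d outside the closed neighbourhood of
-- w, and v w, c d → v c, w d is a 2-switch in G; d can be chosen so that G − v
-- stays connected.  When deg c ≤ deg w the same works in H, and 2-switches are
-- reversible.  Once the neighbourhoods of v agree, induct on G − v and H − v.

open import Defs
import Algebra.Properties.CommutativeMonoid.Sum
open import Data.Bool.Base using (Bool; true; false; T; not; _∧_; _∨_; _xor_)
open import Data.Bool.Properties
  using (T?; T-∧; T-∨; xor-comm; xor-same) renaming (_≟_ to _≟ᵇ_)
open import Data.Empty using (⊥-elim)
open import Data.Fin.Base using (Fin; zero; suc; punchIn; punchOut)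
open import Data.Fin.Properties
  using (_≟_; any?; injective⇒≤; punchIn-injective; punchInᵢ≢i; punchIn-punchOut)
open import Data.Fin.Subset using (∣_∣)
open import Data.List.Base as List using (List; []; _∷_; _∷ʳ_; length; lookup; zip)
import Data.List.Membership.DecPropositional as DecMembership
open import Data.List.Membership.Propositional using (_∈_; _∉_)
open import Data.List.Membership.Propositional.Properties using (∈-lookup)
open import Data.List.Properties using (length-map; map-++; map-∘)
open import Data.List.Relation.Unary.All as All using (All; []; _∷_)
open import Data.List.Relation.Unary.All.Properties using (¬Any⇒All¬)
open import Data.List.Relation.Unary.AllPairs using ([]; _∷_)
open import Data.List.Relation.Unary.Any using (here; there)
open import Data.List.Relation.Unary.Unique.Propositional using (Unique)
open import Data.List.Relation.Unary.Unique.Propositional.Properties using (map⁺)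
open import Data.List.Scans.Base using (scanl)
open import Data.List.Scans.Properties using (scanl-defn)
open import Data.Nat.Base using (ℕ; zero; suc; _+_; _*_; _≤_; _<_; z≤n; s≤s; z<s)
open import Data.Nat.Properties renaming (_≟_ to _≟ℕ_)
open import Data.Nat.Solver using (module +-*-Solver)
open import Data.Product.Base using (∃-syntax; _×_; _,_; proj₁; proj₂)
open import Data.Product.Properties using (≡-dec)
open import Data.Sum.Base using (_⊎_; inj₁; inj₂; [_,_])
open import Data.Vec.Base as Vec using (Vec; tabulate)
open import Data.Vec.Properties using (lookup∘tabulate; tabulate-cong)
open import Function.Base using (_∘_)
open import Function.Bundles using (mk⇔; module Equivalence)
open import Level using (0ℓ)
open import Relation.Binary.Construct.Closure.ReflexiveTransitive as Star
  using (Star; ε; _◅_; _◅◅_)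
open import Relation.Binary.Core using (Rel)
open import Relation.Binary.Definitions using (Decidable; tri<; tri≈; tri>)
open import Relation.Binary.PropositionalEquality
  using (_≡_; _≢_; _≗_; refl; sym; trans; cong; cong₂; subst; subst₂; ≢-sym; module ≡-Reasoning)
open import Relation.Nullary.Decidable
  using (Dec; yes; no; does; dec-true; dec-false; does-⇔; ¬?; _×-dec_; _⊎-dec_; decidable-stable)
open import Relation.Nullary.Negation using (¬_; contradiction)

open Algebra.Properties.CommutativeMonoid.Sum +-0-commutativeMonoid
  using (sum; sum-syntax; sum-cong-≗; sum-remove; ∑-distrib-+)

private
  variable
    n : ℕ

-- Counting with sums of bits

bit : Bool → ℕ
bit true  = 1
bit false = 0

bit≤1 : ∀ b → bit b ≤ 1
bit≤1 true  = ≤-refl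
bit≤1 false = z≤n

0<bit : ∀ {b} → T b → 0 < bit b
0<bit {true} _ = z<s

0<bit⁻ : ∀ {b} → 0 < bit b → T b
0<bit⁻ {true} _ = _

bit-true : ∀ {b} → T b → bit b ≡ 1
bit-true {true} _ = refl

bit-false : ∀ {b} → ¬ T b → bit b ≡ 0
bit-false {true}  ¬b = ⊥-elim (¬b _)
bit-false {false} _  = refl

bit-injective : ∀ {b c} → bit b ≡ bit c → b ≡ c
bit-injective {true}  {true}  _ = refl
bit-injective {false} {false} _ = refl

T-ext : ∀ {b c} → (T b → T c) → (T c → T b) → b ≡ c
T-ext {true}  {true}  _ _ = refl
T-ext {true}  {false} f _ = ⊥-elim (f _)
T-ext {false} {true}  _ g = ⊥-elim (g _)
T-ext {false} {false} _ _ = refl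

sum-mono : {f g : Fin n → ℕ} → (∀ i → f i ≤ g i) → sum f ≤ sum g
sum-mono {zero}  f≤g = z≤n
sum-mono {suc n} f≤g = +-mono-≤ (f≤g zero) (sum-mono (f≤g ∘ suc))

sum-strict : {f g : Fin n → ℕ} (v : Fin n) → (∀ i → f i ≤ g i) → f v < g v → sum f < sum g
sum-strict zero    f≤g fv<gv = +-mono-<-≤ fv<gv (sum-mono (f≤g ∘ suc))
sum-strict (suc v) f≤g fv<gv = +-mono-≤-< (f≤g zero) (sum-strict v (f≤g ∘ suc) fv<gv)

sum-<⇒∃< : (f g : Fin n → ℕ) → sum f < sum g → ∃[ u ] f u < g u
sum-<⇒∃< f g f<g with any? (λ u → f u <? g u)
... | yes found = found
... | no  none  = contradiction f<g (≤⇒≯ (sum-mono λ u → ≮⇒≥ λ lt → none (u , lt)))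

-- Pigeonhole: the deficit of `g` at `v` must be made up elsewhere, since otherwise `sum-strict`
-- would order the sums the wrong way.
sum-≤⇒∃< : (f g : Fin n → ℕ) (v : Fin n) → sum f ≤ sum g → g v < f v → ∃[ u ] f u < g u
sum-≤⇒∃< f g v f≤g gv<fv with any? (λ u → f u <? g u)
... | yes found = found
... | no  none  = contradiction f≤g
  (<⇒≱ (sum-strict v (λ u → ≮⇒≥ λ lt → none (u , lt)) gv<fv))

sum-pinched : (f g : Fin n → ℕ) → (∀ i → f i ≤ g i) → sum g ≤ sum f → ∀ v → f v ≡ g v
sum-pinched f g f≤g g≤f v with m≤n⇒m<n∨m≡n (f≤g v)
... | inj₁ fv<gv = contradiction g≤f (<⇒≱ (sum-strict v f≤g fv<gv))
... | inj₂ fv≡gv = fv≡gv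

sum-const : ∀ n c → sum {n} (λ _ → c) ≡ n * c
sum-const zero    c = refl
sum-const (suc n) c = cong (c +_) (sum-const n c)

δ : Fin n → Fin n → ℕ
δ a u = bit (does (a ≟ u))

δ-diag : (a : Fin n) → δ a a ≡ 1
δ-diag a = cong bit (dec-true (a ≟ a) refl)

δ-off : {a u : Fin n} → a ≢ u → δ a u ≡ 0
δ-off {a = a} {u} a≢u = cong bit (dec-false (a ≟ u) a≢u)

sum-zero : (f : Fin n → ℕ) → (∀ i → f i ≡ 0) → sum f ≡ 0
sum-zero {n} f f≗0 = trans (sum-cong-≗ f≗0) (trans (sum-const n 0) (*-zeroʳ n))

sum-δ : (a : Fin n) → sum (δ a) ≡ 1
sum-δ {suc n} a = trans (sum-remove {i = a} (δ a))
  (cong₂ _+_ (δ-diag a) (sum-zero _ λ i → δ-off (≢-sym (punchInᵢ≢i a i))))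

δ≤bit : (f : Fin n → Bool) {x : Fin n} → T (f x) → ∀ u → δ x u ≤ bit (f u)
δ≤bit f {x} fx u with x ≟ u
... | yes refl = 0<bit fx
... | no  _    = z≤n

one≤sum : (f : Fin n → Bool) {x : Fin n} → T (f x) → 1 ≤ sum (bit ∘ f)
one≤sum f {x} fx = subst (_≤ _) (sum-δ x) (sum-mono (δ≤bit f fx))

sum-two-δ : (x y : Fin n) → sum (λ u → δ x u + δ y u) ≡ 2
sum-two-δ x y = trans (∑-distrib-+ (δ x) (δ y)) (cong₂ _+_ (sum-δ x) (sum-δ y))

two-δ≤bit : (f : Fin n → Bool) {x y : Fin n} → x ≢ y → T (f x) → T (f y) →
            ∀ u → δ x u + δ y u ≤ bit (f u)
two-δ≤bit f {x} {y} x≢y fx fy u with x ≟ u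
... | yes refl = subst (λ k → suc k ≤ _) (sym (δ-off (≢-sym x≢y))) (0<bit fx)
... | no  _    = δ≤bit f fy u

two≤sum : (f : Fin n → Bool) {x y : Fin n} → x ≢ y → T (f x) → T (f y) → 2 ≤ sum (bit ∘ f)
two≤sum f {x} {y} x≢y fx fy =
  subst (_≤ _) (sum-two-δ x y) (sum-mono (two-δ≤bit f x≢y fx fy))

some-member : (f : Fin n → Bool) → 1 ≤ sum (bit ∘ f) → ∃[ x ] T (f x)
some-member {n} f 1≤
  with sum-<⇒∃< (λ _ → 0) (bit ∘ f)
         (subst (_< sum (bit ∘ f)) (sym (sum-zero {n} (λ _ → 0) λ _ → refl)) 1≤)
... | u , lt = u , 0<bit⁻ lt

-- The indicator of `y` sums to 1, so `f` exceeds it at some `u`; it cannot do so at `y`, a bit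
-- being at most 1.
other-member : (f : Fin n → Bool) (y : Fin n) → 2 ≤ sum (bit ∘ f) → ∃[ x ] (x ≢ y × T (f x))
other-member f y 2≤ with sum-<⇒∃< (δ y) (bit ∘ f) (subst (_< _) (sym (sum-δ y)) 2≤)
... | u , lt = u , u≢y , 0<bit⁻ (≤-<-trans z≤n lt)
  where
  u≢y : u ≢ y
  u≢y refl = <⇒≱ lt (subst (_ ≤_) (sym (δ-diag u)) (bit≤1 (f u)))

private
  reassoc : ∀ r s m → (0 + r) + (s + m) ≡ (r + s) + m
  reassoc = solve 3 (λ r s m → (con 0 :+ r) :+ (s :+ m) := (r :+ s) :+ m) refl
    where open +-*-Solver

  double : ∀ r k → (r + r) + 2 * k ≡ 2 * (r + k)
  double = solve 2 (λ r k → (r :+ r) :+ con 2 :* k := con 2 :* (r :+ k)) refl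
    where open +-*-Solver

-- Peel off the first row and column: by symmetry they have the same sum, and the corner is zero.
-- Matrices replace graphs because the lemma is applied to the subgraph induced on a component.
handshake : (f : Fin n → Fin n → ℕ) → (∀ i j → f i j ≡ f j i) → (∀ i → f i i ≡ 0) →
            ∃[ k ] sum (λ i → sum (f i)) ≡ 2 * k
handshake {zero}  f f-sym f-diag = 0 , refl
handshake {suc n} f f-sym f-diag
  with handshake (λ i j → f (suc i) (suc j)) (λ i j → f-sym _ _) (λ i → f-diag _)
... | k , eq = r + k , (begin
  (f zero zero + r) + sum (λ i → f (suc i) zero + sum (f (suc i) ∘ suc))
    ≡⟨ cong₂ (λ x y → (x + r) + y) (f-diag zero) (∑-distrib-+ _ (λ i → sum (f (suc i) ∘ suc))) ⟩
  (0 + r) + (sum (λ i → f (suc i) zero) + m)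
    ≡⟨ cong (λ x → r + (x + m)) (sum-cong-≗ (λ i → f-sym (suc i) zero)) ⟩
  (0 + r) + (r + m)  ≡⟨ reassoc r r m ⟩
  (r + r) + m        ≡⟨ cong (r + r +_) eq ⟩
  (r + r) + 2 * k    ≡⟨ double r k ⟩
  2 * (r + k)        ∎)
  where
  open ≡-Reasoning
  r = sum (f zero ∘ suc)
  m = sum (λ i → sum (f (suc i) ∘ suc))

∣tabulate∣ : (f : Fin n → Bool) → ∣ tabulate f ∣ ≡ sum (bit ∘ f)
∣tabulate∣ {zero}  f = refl
∣tabulate∣ {suc n} f with f zero
... | true  = cong suc (∣tabulate∣ (f ∘ suc))
... | false = ∣tabulate∣ (f ∘ suc)

-- Degrees

T-does : ∀ {P : Set} (P? : Dec P) → P → T (does P?)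
T-does (yes _) _ = _
T-does (no ¬p) p = ⊥-elim (¬p p)

T-does⁻ : ∀ {P : Set} (P? : Dec P) → T (does P?) → P
T-does⁻ (yes p) _ = p

edge-sym : (G : Graph n) {u v : Fin n} → Edge G u v → Edge G v u
edge-sym G {u} {v} = subst T (adj-sym G u v)

edge⇒≢ : (G : Graph n) {u v : Fin n} → Edge G u v → u ≢ v
edge⇒≢ G e refl = loopless G _ e

infix 4 _≐_
-- Equality of Booleans instead of the equivalences in `≈`: it rewrites inside sums of bits and
-- transports edges with `subst`.
_≐_ : Graph n → Graph n → Set
G ≐ H = ∀ u v → adj G u v ≡ adj H u v

≐⇒≈ : {G H : Graph n} → G ≐ H → G ≈ H
≐⇒≈ eq u v = mk⇔ (subst T (eq u v)) (subst T (sym (eq u v)))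

degree-sum : (G : Graph n) (v : Fin n) → degree G v ≡ sum (bit ∘ adj G v)
degree-sum G v = ∣tabulate∣ (adj G v)

degree-cong : {G H : Graph n} → G ≐ H → ∀ v → degree G v ≡ degree H v
degree-cong {G = G} {H} eq v = trans (degree-sum G v)
  (trans (sum-cong-≗ (λ u → cong bit (eq v u))) (sym (degree-sum H v)))

-- Twice the number of edges, so that `2 * n` stands for n edges.
total : Graph n → ℕ
total G = sum (degree G)

-- The graph G - v, its vertices renumbered along `punchIn v`.
del : Fin (suc n) → Graph (suc n) → Graph n
del v G = record
  { adj      = λ i j → adj G (punchIn v i) (punchIn v j)
  ; adj-sym  = λ i j → adj-sym G _ _
  ; loopless = λ i → loopless G _
  }

degree-del : (G : Graph (suc n)) (v : Fin (suc n)) (i : Fin n) →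
             degree G (punchIn v i) ≡ bit (adj G (punchIn v i) v) + degree (del v G) i
degree-del G v i = trans (degree-sum G _) (trans (sum-remove {i = v} (bit ∘ adj G (punchIn v i)))
  (cong (bit (adj G (punchIn v i) v) +_) (sym (degree-sum (del v G) i))))

-- The adjacency matrix loses the row and the column of `v`, each of sum `degree G v`.
total-del : (G : Graph (suc n)) (v : Fin (suc n)) →
            total G ≡ 2 * degree G v + total (del v G)
total-del G v = begin
  total G
    ≡⟨ sum-remove {i = v} (degree G) ⟩
  degree G v + sum (λ i → degree G (punchIn v i))
    ≡⟨ cong (degree G v +_) (trans (sum-cong-≗ (degree-del G v))
                                   (∑-distrib-+ _ (degree (del v G)))) ⟩
  degree G v + (sum (λ i → bit (adj G (punchIn v i) v)) + total (del v G))
    ≡⟨ cong (λ k → degree G v + (k + total (del v G))) column ⟩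
  degree G v + (degree G v + total (del v G))
    ≡⟨ twice (degree G v) _ ⟩
  2 * degree G v + total (del v G) ∎
  where
  open ≡-Reasoning
  twice : ∀ k m → k + (k + m) ≡ 2 * k + m
  twice = solve 2 (λ k m → k :+ (k :+ m) := con 2 :* k :+ m) refl
    where open +-*-Solver
  column : sum (λ i → bit (adj G (punchIn v i) v)) ≡ degree G v
  column = begin
    sum (λ i → bit (adj G (punchIn v i) v))
      ≡⟨ sum-cong-≗ (λ i → cong bit (adj-sym G (punchIn v i) v)) ⟩
    sum (λ i → bit (adj G v (punchIn v i)))
      ≡⟨ cong (_+ sum (λ i → bit (adj G v (punchIn v i)))) (bit-false (loopless G v)) ⟨
    bit (adj G v v) + sum (λ i → bit (adj G v (punchIn v i)))
      ≡⟨ sum-remove {i = v} (bit ∘ adj G v) ⟨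
    sum (bit ∘ adj G v)
      ≡⟨ degree-sum G v ⟨
    degree G v ∎

sum-samePair : {a b : Fin n} → a ≢ b → ∀ u →
               sum (λ v → bit (does (samePair? a b u v))) ≡ δ a u + δ b u
sum-samePair {a = a} {b} a≢b u with a ≟ u | b ≟ u
... | yes refl | yes refl = contradiction refl a≢b
... | yes refl | no _ = trans (sum-cong-≗ λ v → cong bit
        (does-⇔ (mk⇔ (λ { (inj₁ (_ , eq)) → sym eq ; (inj₂ (eq , _)) → ⊥-elim (a≢b eq) })
                     (λ eq → inj₁ (refl , sym eq))) (samePair? a b a v) (b ≟ v)))
        (sum-δ b)
... | no _ | yes refl = trans (sum-cong-≗ λ v → cong bit
        (does-⇔ (mk⇔ (λ { (inj₁ (eq , _)) → ⊥-elim (a≢b (sym eq)) ; (inj₂ (_ , eq)) → sym eq })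
                     (λ eq → inj₂ (refl , sym eq))) (samePair? a b b v) (a ≟ v)))
        (sum-δ a)
... | no a≢u | no b≢u = sum-zero _ λ v → cong bit
        (dec-false (samePair? a b u v)
          λ { (inj₁ (eq , _)) → a≢u (sym eq) ; (inj₂ (eq , _)) → b≢u (sym eq) })

samePair-edge : (G : Graph n) {a b u v : Fin n} → SamePair a b u v → Edge G u v → Edge G a b
samePair-edge G (inj₁ (refl , refl)) e = e
samePair-edge G (inj₂ (refl , refl)) e = edge-sym G e

samePair-edge⁻ : (G : Graph n) {a b u v : Fin n} → SamePair a b u v → Edge G a b → Edge G u v
samePair-edge⁻ G (inj₁ (refl , refl)) e = e
samePair-edge⁻ G (inj₂ (refl , refl)) e = edge-sym G e

samePair-missˡ : {a b u v : Fin n} → u ≢ a → v ≢ a → ¬ SamePair a b u v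
samePair-missˡ u≢a v≢a (inj₁ (u≡a , _)) = u≢a u≡a
samePair-missˡ u≢a v≢a (inj₂ (_ , v≡a)) = v≢a v≡a

samePair-missʳ : {a b u v : Fin n} → u ≢ b → v ≢ b → ¬ SamePair a b u v
samePair-missʳ u≢b v≢b (inj₁ (_ , v≡b)) = v≢b v≡b
samePair-missʳ u≢b v≢b (inj₂ (u≡b , _)) = u≢b u≡b

deleteEdge⁺ : (G : Graph n) {a b u v : Fin n} → Edge G u v → ¬ SamePair a b u v →
              Edge (deleteEdge G a b) u v
deleteEdge⁺ G {a} {b} {u} {v} e ¬p =
  Equivalence.from T-∧ (e , subst (λ x → T (not x)) (sym (dec-false (samePair? a b u v) ¬p)) _)

deleteEdge⁻ : (G : Graph n) {a b u v : Fin n} → Edge (deleteEdge G a b) u v →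
              Edge G u v × ¬ SamePair a b u v
deleteEdge⁻ G {a} {b} {u} {v} e with Equivalence.to T-∧ e
... | e′ , ¬p = e′ , λ p → subst (λ x → T (not x)) (dec-true (samePair? a b u v) p) ¬p

addEdge⁺ˡ : (G : Graph n) {a b u v : Fin n} (a≢b : a ≢ b) → Edge G u v →
           Edge (addEdge G a b a≢b) u v
addEdge⁺ˡ G {u = u} {v} a≢b = Equivalence.from (T-∨ {adj G u v}) ∘ inj₁

addEdge⁺ʳ : (G : Graph n) {a b u v : Fin n} (a≢b : a ≢ b) → SamePair a b u v →
           Edge (addEdge G a b a≢b) u v
addEdge⁺ʳ G {a} {b} {u} {v} a≢b p =
  Equivalence.from (T-∨ {adj G u v}) (inj₂ (T-does (samePair? a b u v) p))

addEdge⁻ : (G : Graph n) {a b u v : Fin n} (a≢b : a ≢ b) → Edge (addEdge G a b a≢b) u v →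
           Edge G u v ⊎ SamePair a b u v
addEdge⁻ G {a} {b} {u} {v} a≢b e with Equivalence.to T-∨ e
... | inj₁ e′ = inj₁ e′
... | inj₂ p  = inj₂ (T-does⁻ (samePair? a b u v) p)

-- The bits of `G` split into those that remain and those of the pair ab, exactly because ab is an
-- edge. The additive form avoids truncated subtraction.
degree-deleteEdge : (G : Graph n) {a b : Fin n} → Edge G a b → ∀ u →
                    degree G u ≡ degree (deleteEdge G a b) u + (δ a u + δ b u)
degree-deleteEdge G {a} {b} ab u = begin
  degree G u
    ≡⟨ degree-sum G u ⟩
  sum (bit ∘ adj G u)
    ≡⟨ sum-cong-≗ (λ v → split (λ p → samePair-edge⁻ G (T-does⁻ (samePair? a b u v) p) ab)) ⟩
  sum (λ v → bit (adj G′ u v) + bit (does (samePair? a b u v)))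
    ≡⟨ ∑-distrib-+ (bit ∘ adj G′ u) _ ⟩
  sum (bit ∘ adj G′ u) + sum (λ v → bit (does (samePair? a b u v)))
    ≡⟨ cong₂ _+_ (sym (degree-sum G′ u)) (sum-samePair (edge⇒≢ G ab) u) ⟩
  degree G′ u + (δ a u + δ b u) ∎
  where
  open ≡-Reasoning
  G′ = deleteEdge G a b
  split : ∀ {x p} → (T p → T x) → bit x ≡ bit (x ∧ not p) + bit p
  split {true}  {true}  _ = refl
  split {true}  {false} _ = refl
  split {false} {true}  f = ⊥-elim (f _)
  split {false} {false} _ = refl

-- Since ab is no edge, the two disjuncts are never both true, and the bit of the disjunction is the
-- sum of the bits.
degree-addEdge : (G : Graph n) {a b : Fin n} (a≢b : a ≢ b) → ¬ Edge G a b → ∀ u →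
                 degree (addEdge G a b a≢b) u ≡ degree G u + (δ a u + δ b u)
degree-addEdge G {a} {b} a≢b ¬ab u = begin
  degree G′ u
    ≡⟨ degree-sum G′ u ⟩
  sum (bit ∘ adj G′ u)
    ≡⟨ sum-cong-≗ (λ v → split (λ p → ¬ab ∘ samePair-edge G (T-does⁻ (samePair? a b u v) p))) ⟩
  sum (λ v → bit (adj G u v) + bit (does (samePair? a b u v)))
    ≡⟨ ∑-distrib-+ (bit ∘ adj G u) _ ⟩
  sum (bit ∘ adj G u) + sum (λ v → bit (does (samePair? a b u v)))
    ≡⟨ cong₂ _+_ (sym (degree-sum G u)) (sum-samePair a≢b u) ⟩
  degree G u + (δ a u + δ b u) ∎
  where
  open ≡-Reasoning
  G′ = addEdge G a b a≢b
  split : ∀ {x p} → (T p → ¬ T x) → bit (x ∨ p) ≡ bit x + bit p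
  split {true}  {true}  f = ⊥-elim (f _ _)
  split {true}  {false} _ = refl
  split {false} {true}  _ = refl
  split {false} {false} _ = refl

total-deleteEdge : (G : Graph n) {a b : Fin n} → Edge G a b → total G ≡ total (deleteEdge G a b) + 2
total-deleteEdge G {a} {b} ab = trans (sum-cong-≗ (degree-deleteEdge G ab))
  (trans (∑-distrib-+ (degree (deleteEdge G a b)) _)
         (cong (total (deleteEdge G a b) +_) (sum-two-δ a b)))

-- 2-switches

-- Symmetric in G and H up to exchanging b and c, so that 2-switches can be undone.
record SwitchAt (a b c d : Fin n) (G H : Graph n) : Set where
  field
    disjoint : Disjoint a b c d
    removed  : (Edge G a b × Edge G c d) × (¬ Edge H a b × ¬ Edge H c d)
    added    : (Edge H a c × Edge H b d) × (¬ Edge G a c × ¬ Edge G b d)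
    agree    : ∀ {u v} → ¬ SamePair a b u v → ¬ SamePair c d u v →
               ¬ SamePair a c u v → ¬ SamePair b d u v → adj G u v ≡ adj H u v

open SwitchAt public

switch-sym : {a b c d : Fin n} {G H : Graph n} → SwitchAt a b c d G H → SwitchAt a c b d H G
switch-sym {G = G} S@record { disjoint = (_ , a≢d) , (b≢c , _) ; removed = (ab , cd) , _ } = record
  { disjoint = (edge⇒≢ G ab , a≢d) , (≢-sym b≢c , edge⇒≢ G cd)
  ; removed  = added S
  ; added    = removed S
  ; agree    = λ ¬ac ¬bd ¬ab ¬cd → sym (agree S ¬ab ¬cd ¬ac ¬bd)
  }

switch-respˡ : {a b c d : Fin n} {G G′ H : Graph n} → G ≐ G′ →
               SwitchAt a b c d G H → SwitchAt a b c d G′ H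
switch-respˡ {G = G} {G′} eq record
  { disjoint = dis ; removed = (ab , cd) , ¬s ; added = s , (¬ac , ¬bd) ; agree = agr } = record
  { disjoint = dis
  ; removed  = (to ab , to cd) , ¬s
  ; added    = s , (¬ac ∘ from , ¬bd ∘ from)
  ; agree    = λ {u} {v} p q r s → trans (sym (eq u v)) (agr p q r s)
  }
  where
  to : ∀ {u v} → Edge G u v → Edge G′ u v
  to = subst T (eq _ _)
  from : ∀ {u v} → Edge G′ u v → Edge G u v
  from = subst T (sym (eq _ _))

switch-respʳ : {a b c d : Fin n} {G H H′ : Graph n} → H ≐ H′ →
               SwitchAt a b c d G H → SwitchAt a b c d G H′
switch-respʳ eq = switch-sym ∘ switch-respˡ eq ∘ switch-sym

-- The value on each of the four switched pairs is prescribed, and everywhere else both graphs agree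
-- with `G`.
switch-unique : {a b c d : Fin n} {G H K : Graph n} →
                SwitchAt a b c d G H → SwitchAt a b c d G K → H ≐ K
switch-unique {a = a} {b} {c} {d} {G} {H} {K} S S′ u v with samePair? a b u v
... | yes p = T-ext (λ e → ⊥-elim (proj₁ (proj₂ (removed S)) (samePair-edge H p e)))
                    (λ e → ⊥-elim (proj₁ (proj₂ (removed S′)) (samePair-edge K p e)))
... | no ¬ab with samePair? c d u v
...   | yes p = T-ext (λ e → ⊥-elim (proj₂ (proj₂ (removed S)) (samePair-edge H p e)))
                      (λ e → ⊥-elim (proj₂ (proj₂ (removed S′)) (samePair-edge K p e)))
...   | no ¬cd with samePair? a c u v
...     | yes p = T-ext (λ _ → samePair-edge⁻ K p (proj₁ (proj₁ (added S′))))
                        (λ _ → samePair-edge⁻ H p (proj₁ (proj₁ (added S))))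
...     | no ¬ac with samePair? b d u v
...       | yes p = T-ext (λ _ → samePair-edge⁻ K p (proj₂ (proj₁ (added S′))))
                          (λ _ → samePair-edge⁻ H p (proj₂ (proj₁ (added S))))
...       | no ¬bd = trans (sym (agree S ¬ab ¬cd ¬ac ¬bd)) (agree S′ ¬ab ¬cd ¬ac ¬bd)

switch-interchangeable : {a b c d : Fin n} {G H : Graph n} → SwitchAt a b c d G H →
                         Interchangeable (matrix a b c d) G
switch-interchangeable S = proj₁ (removed S) , disjoint S , proj₂ (added S)

interchange-switch : {a b c d : Fin n} (G : Graph n) (i : Interchangeable (matrix a b c d) G) →
                     SwitchAt a b c d G (interchange (matrix a b c d) G i)
interchange-switch {a = a} {b} {c} {d} G
  ((ab , cd) , dis@((a≢c , a≢d) , (b≢c , b≢d)) , (¬ac , ¬bd)) = record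
  { disjoint = dis
  ; removed  = (ab , cd) , (¬ab , ¬cd)
  ; added    = ( addEdge⁺ˡ G₃ b≢d (addEdge⁺ʳ G₂ a≢c (inj₁ (refl , refl)))
               , addEdge⁺ʳ G₃ b≢d (inj₁ (refl , refl)) )
             , (¬ac , ¬bd)
  ; agree    = λ p q r s → T-ext
      (λ e → addEdge⁺ˡ G₃ b≢d (addEdge⁺ˡ G₂ a≢c (deleteEdge⁺ G₁ (deleteEdge⁺ G e p) q)))
      (λ e → [ (λ e₃ → [ (λ e₂ → proj₁ (deleteEdge⁻ G (proj₁ (deleteEdge⁻ G₁ e₂)))) , ⊥-elim ∘ r ]
                         (addEdge⁻ G₂ a≢c e₃)) , ⊥-elim ∘ s ]
               (addEdge⁻ G₃ b≢d e))
  }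
  where
  G₁ = deleteEdge G a b
  G₂ = deleteEdge G₁ c d
  G₃ = addEdge G₂ a c a≢c
  G₄ = addEdge G₃ b d b≢d
  ¬ab : ¬ Edge G₄ a b
  ¬ab e with addEdge⁻ G₃ b≢d e
  ... | inj₂ (inj₁ (a≡b , _)) = edge⇒≢ G ab a≡b
  ... | inj₂ (inj₂ (a≡d , _)) = a≢d a≡d
  ... | inj₁ e₃ with addEdge⁻ G₂ a≢c e₃
  ...   | inj₁ e₂ = proj₂ (deleteEdge⁻ G (proj₁ (deleteEdge⁻ G₁ e₂))) (inj₁ (refl , refl))
  ...   | inj₂ (inj₁ (_ , b≡c)) = b≢c b≡c
  ...   | inj₂ (inj₂ (a≡c , _)) = a≢c a≡c
  ¬cd : ¬ Edge G₄ c d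
  ¬cd e with addEdge⁻ G₃ b≢d e
  ... | inj₂ (inj₁ (c≡b , _)) = b≢c (sym c≡b)
  ... | inj₂ (inj₂ (c≡d , _)) = edge⇒≢ G cd c≡d
  ... | inj₁ e₃ with addEdge⁻ G₂ a≢c e₃
  ...   | inj₁ e₂ = proj₂ (deleteEdge⁻ G₁ e₂) (inj₁ (refl , refl))
  ...   | inj₂ (inj₁ (c≡a , _)) = a≢c (sym c≡a)
  ...   | inj₂ (inj₂ (_ , d≡a)) = a≢d (sym d≡a)

-- Each of `a`, `b`, `c`, `d` loses one edge and gains one. Interchangeability makes every deletion
-- hit an edge and every addition a non-edge, also in the intermediate graphs.
interchange-degree : {a b c d : Fin n} (G : Graph n) (i : Interchangeable (matrix a b c d) G) →
                     ∀ u → degree (interchange (matrix a b c d) G i) u ≡ degree G u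
interchange-degree {a = a} {b} {c} {d} G
  ((ab , cd) , ((a≢c , a≢d) , (b≢c , b≢d)) , (¬ac , ¬bd)) u = begin
  degree G₄ u
    ≡⟨ degree-addEdge G₃ b≢d ¬bd₃ u ⟩
  degree G₃ u + (δ b u + δ d u)
    ≡⟨ cong (_+ (δ b u + δ d u)) (degree-addEdge G₂ a≢c ¬ac₂ u) ⟩
  (degree G₂ u + (δ a u + δ c u)) + (δ b u + δ d u)
    ≡⟨ shuffle (degree G₂ u) (δ a u) (δ b u) (δ c u) (δ d u) ⟩
  (degree G₂ u + (δ c u + δ d u)) + (δ a u + δ b u)
    ≡⟨ cong (_+ (δ a u + δ b u)) (degree-deleteEdge G₁ (deleteEdge⁺ G cd ¬cd≡ab) u) ⟨
  degree G₁ u + (δ a u + δ b u)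
    ≡⟨ degree-deleteEdge G ab u ⟨
  degree G u ∎
  where
  open ≡-Reasoning
  G₁ = deleteEdge G a b
  G₂ = deleteEdge G₁ c d
  G₃ = addEdge G₂ a c a≢c
  G₄ = addEdge G₃ b d b≢d
  ¬cd≡ab : ¬ SamePair a b c d
  ¬cd≡ab (inj₁ (c≡a , _)) = a≢c (sym c≡a)
  ¬cd≡ab (inj₂ (c≡b , _)) = b≢c (sym c≡b)
  G₂⊆G : ∀ {u v} → Edge G₂ u v → Edge G u v
  G₂⊆G e = proj₁ (deleteEdge⁻ G (proj₁ (deleteEdge⁻ G₁ e)))
  ¬ac₂ : ¬ Edge G₂ a c
  ¬ac₂ = ¬ac ∘ G₂⊆G
  ¬bd₃ : ¬ Edge G₃ b d
  ¬bd₃ e with addEdge⁻ G₂ a≢c e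
  ... | inj₁ e₂ = ¬bd (G₂⊆G e₂)
  ... | inj₂ (inj₁ (b≡a , _)) = edge⇒≢ G ab (sym b≡a)
  ... | inj₂ (inj₂ (b≡c , _)) = b≢c b≡c
  shuffle : ∀ k a b c d → (k + (a + c)) + (b + d) ≡ (k + (c + d)) + (a + b)
  shuffle = solve 5 (λ k a b c d → (k :+ (a :+ c)) :+ (b :+ d) := (k :+ (c :+ d)) :+ (a :+ b)) refl
    where open +-*-Solver

switch-degree : {a b c d : Fin n} {G H : Graph n} → SwitchAt a b c d G H →
                ∀ u → degree H u ≡ degree G u
switch-degree {a = a} {b} {c} {d} {G} {H} S u = trans
  (degree-cong {G = H} {H = interchange (matrix a b c d) G i}
    (switch-unique S (interchange-switch G i)) u)
  (interchange-degree G i u)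
  where i = switch-interchangeable S

-- Components and non-cut vertices

lookup-injective : {L : List (Fin n)} → Unique L → ∀ i j → lookup L i ≡ lookup L j → i ≡ j
lookup-injective (_ ∷ _)  zero    zero    _  = refl
lookup-injective (x∉ ∷ _) zero    (suc j) eq = ⊥-elim (All.lookup x∉ (∈-lookup j) eq)
lookup-injective (x∉ ∷ _) (suc i) zero    eq = ⊥-elim (All.lookup x∉ (∈-lookup i) (sym eq))
lookup-injective (_ ∷ u)  (suc i) (suc j) eq = cong suc (lookup-injective u i j eq)

unique-length : {L : List (Fin n)} → Unique L → length L ≤ n
unique-length u = injective⇒≤ (lookup-injective u _ _)

-- Vertices in the reverse order of a search from `r`: each is new and is reached by `R` from an
-- earlier one. Removing the head of a longer list therefore leaves a search that is still valid.
data Grown (R : Rel (Fin n) 0ℓ) (r : Fin n) : List (Fin n) → Set where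
  root : Grown R r (r ∷ [])
  grow : ∀ {L x y} → Grown R r L → x ∈ L → R x y → y ∉ L → Grown R r (y ∷ L)

Closed : Rel (Fin n) 0ℓ → List (Fin n) → Set
Closed R L = ∀ {x y} → x ∈ L → R x y → y ∈ L

Within : Rel (Fin n) 0ℓ → List (Fin n) → Rel (Fin n) 0ℓ
Within R L x y = R x y × x ∈ L × y ∈ L

closed-walk : {R : Rel (Fin n) 0ℓ} {L : List (Fin n)} {x y : Fin n} →
              Closed R L → x ∈ L → Star R x y → y ∈ L
closed-walk closed x∈L ε         = x∈L
closed-walk closed x∈L (Rxz ◅ s) = closed-walk closed (closed x∈L Rxz) s

module _ {R : Rel (Fin n) 0ℓ} {r : Fin n} where

  grown-unique : ∀ {L} → Grown R r L → Unique L
  grown-unique root             = [] ∷ []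
  grown-unique (grow g _ _ y∉L) = ¬Any⇒All¬ _ y∉L ∷ grown-unique g

  grown-root : ∀ {L} → Grown R r L → r ∈ L
  grown-root root           = here refl
  grown-root (grow g _ _ _) = there (grown-root g)

  grown-walk : ∀ {L u} → Grown R r L → u ∈ L → Star (Within R L) r u
  grown-walk root (here refl) = ε
  grown-walk (grow {L} {x} {y} g x∈L Rxy _) = λ
    { (here refl) → Star.map weaken (grown-walk g x∈L) ◅◅ (Rxy , there x∈L , here refl) ◅ ε
    ; (there u∈L) → Star.map weaken (grown-walk g u∈L)
    }
    where
    weaken : ∀ {a b} → Within R L a b → Within R (y ∷ L) a b
    weaken (Rab , a∈L , b∈L) = Rab , there a∈L , there b∈L

component : {R : Rel (Fin n) 0ℓ} → Decidable R → ∀ r → ∃[ L ] (Grown R r L × Closed R L)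
component {n} {R} R? r = extend n root (≤-reflexive (+-comm 1 n))
  where
  open DecMembership {A = Fin n} _≟_ using (_∈?_)
  -- `k` is fuel: it drops as `L` grows, so the inequality persists, and at zero the duplicate-free
  -- `L` would have more than n entries.
  extend : ∀ k {L} → Grown R r L → n < k + length L → ∃[ L ] (Grown R r L × Closed R L)
  extend zero    g n<L = contradiction n<L (≤⇒≯ (unique-length (grown-unique g)))
  extend (suc k) {L} g n<k+L
    with any? (λ x → any? (λ y → (x ∈? L) ×-dec R? x y ×-dec ¬? (y ∈? L)))
  ... | yes (x , y , x∈L , Rxy , y∉L) =
        extend k (grow g x∈L Rxy y∉L) (subst (n <_) (sym (+-suc k (length L))) n<k+L)
  ... | no none = L , g , λ {x} {y} x∈L Rxy → decidable-stable (y ∈? L) λ y∉L →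
        none (x , y , x∈L , Rxy , y∉L)

walk-first : {R : Rel (Fin n) 0ℓ} {x y : Fin n} → Star R x y → x ≢ y → ∃[ z ] R x z
walk-first ε         x≢y = contradiction refl x≢y
walk-first (Rxz ◅ _) _   = _ , Rxz

-- The edges of G − v, kept on the vertices of G.
Avoid : Graph n → Fin n → Rel (Fin n) 0ℓ
Avoid G v x y = Edge G x y × x ≢ v × y ≢ v

ConnectedOff : Graph n → Fin n → Set
ConnectedOff G v = ∀ {x y} → x ≢ v → y ≢ v → Star (Avoid G v) x y

avoid-sym : (G : Graph n) {v x y : Fin n} → Avoid G v x y → Avoid G v y x
avoid-sym G (e , x≢v , y≢v) = edge-sym G e , y≢v , x≢v

avoid? : (G : Graph n) (v : Fin n) → Decidable (Avoid G v)
avoid? G v x y = T? (adj G x y) ×-dec ¬? (x ≟ v) ×-dec ¬? (y ≟ v)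

avoid-end : {G : Graph n} {v x y : Fin n} → x ≢ v → Star (Avoid G v) x y → y ≢ v
avoid-end x≢v ε                   = x≢v
avoid-end {G = G} x≢v ((_ , _ , z≢v) ◅ s) = avoid-end {G = G} z≢v s

connectedOff⇒connected-del : (G : Graph (suc n)) {v : Fin (suc n)} →
                             ConnectedOff G v → Connected (del v G)
connectedOff⇒connected-del G {v} off i j =
  descend refl refl (off (punchInᵢ≢i v i) (punchInᵢ≢i v j))
  where
  -- The endpoints are tied by equations because the inner vertices of the walk are images under
  -- `punchIn v` only propositionally.
  descend : ∀ {x y i j} → punchIn v i ≡ x → punchIn v j ≡ y →
            Star (Avoid G v) x y → Star (Edge (del v G)) i j
  descend {i = i} {j} i≡x j≡y ε =
    subst (Star _ i) (punchIn-injective v i j (trans i≡x (sym j≡y))) ε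
  descend refl j≡y ((e , _ , z≢v) ◅ s) =
    subst (Edge G _) (sym (punchIn-punchOut (≢-sym z≢v))) e
      ◅ descend (punchIn-punchOut (≢-sym z≢v)) j≡y s

connectedOff⇒connected : (G : Graph n) {v c : Fin n} → ConnectedOff G v → Edge G v c → Connected G
connectedOff⇒connected G {v} {c} off vc x y = toC x ◅◅ Star.reverse (edge-sym G) (toC y)
  where
  toC : ∀ x → Star (Edge G) x c
  toC x with x ≟ v
  ... | yes refl = vc ◅ ε
  ... | no x≢v   = Star.map proj₁ (off x≢v (≢-sym (edge⇒≢ G vc)))

-- Each visit of a walk to `v` is replaced by a detour between the vertices just before and just
-- after it.
bypass : (G : Graph n) {v : Fin n} → Connected G →
         (∀ {a b} → Edge G v a → Edge G v b → Star (Avoid G v) a b) → ConnectedOff G v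
bypass G {v} conn detour {x} {y} x≢v y≢v = reroute x≢v (conn x y)
  where
  reroute : ∀ {x} → x ≢ v → Star (Edge G) x y → Star (Avoid G v) x y
  reroute x≢v ε = ε
  reroute x≢v (_◅_ {j = z} e s) with z ≟ v
  ... | no z≢v = (e , x≢v , z≢v) ◅ reroute z≢v s
  reroute x≢v (e ◅ ε)     | yes refl = contradiction refl y≢v
  reroute x≢v (e ◅ f ◅ s) | yes refl =
    detour (edge-sym G e) f ◅◅ reroute (≢-sym (edge⇒≢ G f)) s

-- Take the vertex found last in a search of the whole graph: all others were reached before it, by
-- walks inside the earlier part.
exists-noncut : (G : Graph (suc (suc n))) → Connected G → ∃[ v ] ConnectedOff G v
exists-noncut G conn with component (λ x y → T? (adj G x y)) zero
-- A search that stops at its root contradicts the existence of a second vertex.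
... | _ , root , closed with closed-walk closed (here refl) (conn zero (suc zero))
...   | here ()
...   | there ()
exists-noncut G conn | _ , grow {L} {y = v} g x∈L e v∉L , closed =
  v , λ {x} {y} x≢v y≢v → Star.reverse (avoid-sym G) (fromRoot x≢v) ◅◅ fromRoot y≢v
  where
  reached : ∀ {u} → u ≢ v → u ∈ L
  reached {u} u≢v with closed-walk closed (there (grown-root g)) (conn zero u)
  ... | here u≡v  = contradiction u≡v u≢v
  ... | there u∈L = u∈L
  fromRoot : ∀ {u} → u ≢ v → Star (Avoid G v) zero u
  fromRoot u≢v = Star.map
    (λ (e , a∈L , b∈L) → e , (λ { refl → v∉L a∈L }) , (λ { refl → v∉L b∈L }))
    (grown-walk g (reached u≢v))

one≤degree : (G : Graph n) {u w : Fin n} → Edge G u w → 1 ≤ degree G u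
one≤degree G {u} e = subst (1 ≤_) (sym (degree-sum G u)) (one≤sum (adj G u) e)

two≤degree : (G : Graph n) {u w x : Fin n} → w ≢ x → Edge G u w → Edge G u x → 2 ≤ degree G u
two≤degree G {u} w≢x e f = subst (2 ≤_) (sym (degree-sum G u)) (two≤sum (adj G u) w≢x e f)

connected⇒one≤degree : (G : Graph (suc (suc n))) → Connected G → ∀ u → 1 ≤ degree G u
connected⇒one≤degree G conn u = one≤degree G
  (proj₂ (walk-first (conn u (punchIn u zero)) (≢-sym (punchInᵢ≢i u zero))))

-- Two neighbours of a leaf coincide, so the detour demanded by `bypass` is empty.
leaf-noncut : (G : Graph n) → Connected G → {v : Fin n} → degree G v ≡ 1 → ConnectedOff G v
leaf-noncut G conn {v} leaf = bypass G conn same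
  where
  same : ∀ {a b} → Edge G v a → Edge G v b → Star (Avoid G v) a b
  same {a} {b} va vb with a ≟ b
  ... | yes refl = ε
  ... | no a≢b   = contradiction (subst (2 ≤_) leaf (two≤degree G a≢b va vb)) λ { (s≤s ()) }

-- In a 2-regular graph, the component L of a in G − v contains the other
-- neighbour b of v: otherwise a is the only vertex of odd degree in L.
two-regular-noncut : (G : Graph n) → Connected G → (∀ u → degree G u ≡ 2) →
                     ∀ v → ConnectedOff G v
two-regular-noncut {n} G conn regular v = bypass G conn detour
  where
  open DecMembership {A = Fin n} _≟_ using (_∈?_)
  detour : ∀ {a b} → Edge G v a → Edge G v b → Star (Avoid G v) a b
  detour {a} {b} va vb with component (avoid? G v) a
  ... | L , g , closed with b ∈? L
  ...   | yes b∈L = Star.map proj₁ (grown-walk g b∈L)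
  ...   | no  b∉L = contradiction odd (even≢odd (sum (bit ∘ K)) (proj₁ even))
    where
    -- `K` is the indicator of `L`, and `f` the adjacency matrix of the subgraph induced on `L`,
    -- padded with zeros.
    K : Fin n → Bool
    K i = does (i ∈? L)
    f : Fin n → Fin n → ℕ
    f i j = bit (K i ∧ (K j ∧ adj G i j))
    a≢v : a ≢ v
    a≢v = ≢-sym (edge⇒≢ G va)
    a≢b : a ≢ b
    a≢b refl = b∉L (grown-root g)
    v∉L : v ∉ L
    v∉L v∈L = avoid-end {G = G} a≢v (Star.map proj₁ (grown-walk g v∈L)) refl
    even : ∃[ k ] sum (λ i → sum (f i)) ≡ 2 * k
    even = handshake f
      (λ i j → cong bit (f-sym (K i) (K j) (adj-sym G i j)))
      (λ i → bit-false λ t → loopless G i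
        (proj₂ (Equivalence.to (T-∧ {K i}) (proj₂ (Equivalence.to (T-∧ {K i}) t)))))
      where
      f-sym : ∀ p q {r s} → r ≡ s → p ∧ (q ∧ r) ≡ q ∧ (p ∧ s)
      f-sym true  true  refl = refl
      f-sym true  false refl = refl
      f-sym false true  refl = refl
      f-sym false false refl = refl
    -- Since `v` has degree 2, the neighbours `a` and `b` exhaust its row.
    neighbour-v : ∀ {i} → Edge G v i → i ≢ b → i ≡ a
    neighbour-v {i} vi i≢b with a ≟ i
    ... | yes a≡i = sym a≡i
    ... | no  a≢i = contradiction
        (trans (sym (cong₂ _+_ (δ-off {a = a} a≢i) (δ-off {a = b} (≢-sym i≢b))))
               (trans pinched (bit-true vi))) λ ()
      where
      pinched : δ a i + δ b i ≡ bit (adj G v i)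
      pinched = sum-pinched _ _ (two-δ≤bit (adj G v) a≢b va vb)
        (≤-reflexive (trans (sym (degree-sum G v)) (trans (regular v) (sym (sum-two-δ a b))))) i
    -- The edge av is the only one leaving `L`: `L` is closed in G - v, and the other neighbour `b`
    -- of `v` lies outside.
    inside : ∀ {i} j → i ∈ L → bit (adj G i j) ≡ f i j + bit (does (a ≟ i) ∧ does (v ≟ j))
    inside {i} j i∈L with i ∈? L | j ∈? L | a ≟ i | v ≟ j
    ... | no i∉L | _       | _        | _        = contradiction i∈L i∉L
    ... | yes _  | yes v∈L | _        | yes refl = contradiction v∈L v∉L
    ... | yes _  | no _    | yes refl | yes refl = bit-true (edge-sym G va)
    ... | yes _  | no _    | no a≢i   | yes refl = bit-false λ iv →
          a≢i (sym (neighbour-v (edge-sym G iv) λ { refl → b∉L i∈L }))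
    ... | yes _  | yes _   | yes _    | no _     = sym (+-identityʳ _)
    ... | yes _  | yes _   | no _     | no _     = sym (+-identityʳ _)
    ... | yes _  | no j∉L  | yes _    | no v≢j   = bit-false λ ij →
          j∉L (closed i∈L (ij , (λ { refl → v∉L i∈L }) , ≢-sym v≢j))
    ... | yes _  | no j∉L  | no _     | no v≢j   = bit-false λ ij →
          j∉L (closed i∈L (ij , (λ { refl → v∉L i∈L }) , ≢-sym v≢j))
    sum-entry : ∀ i → sum (λ j → bit (does (a ≟ i) ∧ does (v ≟ j))) ≡ δ a i
    sum-entry i with a ≟ i
    ... | yes _ = sum-δ v
    ... | no  _ = sum-zero {n} (λ _ → 0) λ _ → refl
    inside-row : ∀ {i} → i ∈ L → sum (f i) + δ a i ≡ 2
    inside-row {i} i∈L = begin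
      sum (f i) + δ a i
        ≡⟨ cong (sum (f i) +_) (sum-entry i) ⟨
      sum (f i) + sum (λ j → bit (does (a ≟ i) ∧ does (v ≟ j)))
        ≡⟨ ∑-distrib-+ (f i) _ ⟨
      sum (λ j → f i j + bit (does (a ≟ i) ∧ does (v ≟ j)))
        ≡⟨ sum-cong-≗ (λ j → inside j i∈L) ⟨
      sum (bit ∘ adj G i)
        ≡⟨ degree-sum G i ⟨
      degree G i
        ≡⟨ regular i ⟩
      2 ∎
      where open ≡-Reasoning
    row : ∀ i → sum (f i) + δ a i ≡ bit (K i) + bit (K i)
    row i with i ∈? L | inside-row {i}
    ... | yes i∈L | eq = eq i∈L
    ... | no  i∉L | _  = cong₂ _+_ (sum-zero {n} (λ _ → 0) λ _ → refl)
                                   (δ-off {a = a} {i} λ { refl → i∉L (grown-root g) })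
    -- The degrees of the vertices in `L` total twice its size; the induced subgraph accounts for
    -- all but one of this, an even amount.
    odd : 2 * sum (bit ∘ K) ≡ suc (2 * proj₁ even)
    odd = begin
      2 * sum (bit ∘ K)
        ≡⟨ cong (sum (bit ∘ K) +_) (+-identityʳ _) ⟩
      sum (bit ∘ K) + sum (bit ∘ K)
        ≡⟨ ∑-distrib-+ (bit ∘ K) (bit ∘ K) ⟨
      sum (λ i → bit (K i) + bit (K i))
        ≡⟨ sum-cong-≗ row ⟨
      sum (λ i → sum (f i) + δ a i)
        ≡⟨ ∑-distrib-+ (λ i → sum (f i)) (δ a) ⟩
      sum (λ i → sum (f i)) + sum (δ a)
        ≡⟨ cong₂ _+_ (proj₂ even) (sum-δ a) ⟩
      2 * proj₁ even + 1
        ≡⟨ +-comm (2 * proj₁ even) 1 ⟩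
      suc (2 * proj₁ even) ∎
      where open ≡-Reasoning

-- Without leaves all degrees are at least 2, while their sum is at most twice the number of
-- vertices.
edges-dichotomy : (G : Graph (suc (suc n))) → Connected G → total G ≤ 2 * suc (suc n) →
                  (∃[ v ] degree G v ≡ 1) ⊎ (∀ v → degree G v ≡ 2)
edges-dichotomy {n} G conn few with any? (λ v → degree G v ≟ℕ 1)
... | yes leaf = inj₁ leaf
... | no  none = inj₂ λ v → sym (sum-pinched (λ _ → 2) (degree G)
  (λ u → ≤∧≢⇒< (connected⇒one≤degree G conn u) λ eq → none (u , sym eq))
  (subst (total G ≤_) (trans (*-comm 2 (suc (suc n))) (sym (sum-const (suc (suc n)) 2))) few) v)

-- Aligning the neighbourhood of a vertex

-- Cut the walk at its first visit to `c`: everything before the last edge yc avoids `c`, hence uses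
-- no edge at `c`.
first-arrival : {R : Rel (Fin n) 0ℓ} {w c : Fin n} → Star R w c → w ≢ c →
                ∃[ y ] (Star (λ x z → R x z × x ≢ c × z ≢ c) w y × R y c × y ≢ c)
first-arrival ε w≢c = contradiction refl w≢c
first-arrival {c = c} (_◅_ {j = x} e s) w≢c with x ≟ c
... | yes refl = _ , ε , e , w≢c
... | no x≢c with first-arrival s x≢c
...   | y , s′ , e′ , y≢c = y , (e , w≢c , x≢c) ◅ s′ , e′ , y≢c

bit-<⁻ : ∀ {p q} → bit p < bit q → T q × ¬ T p
bit-<⁻ {false} {true} _ = _ , λ ()
bit-<⁻ {true}  {true} (s≤s ())

-- The neighbour `v` of `w` is not one of `c`, yet `c` has at least as many, so some `d` is a
-- neighbour of `c` and not of `w`. If wc is no edge, then `d` differs from `w` automatically;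
-- otherwise closed neighbourhoods are compared.
private-neighbour : (G : Graph n) {v w c : Fin n} → v ≢ c → Edge G v w → ¬ Edge G v c →
                    degree G w ≤ degree G c → ∃[ d ] (Edge G c d × d ≢ w × ¬ Edge G w d)
private-neighbour {n} G {v} {w} {c} v≢c vw ¬vc w≤c with T? (adj G w c)
... | no ¬wc =
      let d , lt   = sum-≤⇒∃< (bit ∘ adj G w) (bit ∘ adj G c) v
                       (subst₂ _≤_ (degree-sum G w) (degree-sum G c) w≤c)
                       (subst₂ _<_ (sym (bit-false (¬vc ∘ edge-sym G)))
                                  (sym (bit-true (edge-sym G vw))) z<s)
          cd , ¬wd = bit-<⁻ lt
      in d , cd , (λ d≡w → ¬wc (edge-sym G (subst (Edge G c) d≡w cd))) , ¬wd
... | yes wc =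
      let d , lt         = sum-≤⇒∃< (closed w) (closed c) v closed-≤ at-v
          cd , d≢w , ¬wd = strict d lt
      in d , cd , d≢w , ¬wd
  where
  w≢c : w ≢ c
  w≢c = edge⇒≢ G wc
  -- Closed neighbourhoods, in which neither w nor c can witness the excess.
  closed : Fin n → Fin n → ℕ
  closed x u = bit (adj G x u) + δ x u
  sum-closed : ∀ x → sum (closed x) ≡ degree G x + 1
  sum-closed x = trans (∑-distrib-+ (bit ∘ adj G x) (δ x))
                       (cong₂ _+_ (sym (degree-sum G x)) (sum-δ x))
  closed-≤ : sum (closed w) ≤ sum (closed c)
  closed-≤ = subst₂ _≤_ (sym (sum-closed w)) (sym (sum-closed c)) (+-monoˡ-≤ 1 w≤c)
  at-v : closed c v < closed w v
  at-v = subst₂ _<_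
    (sym (cong₂ _+_ (bit-false (¬vc ∘ edge-sym G)) (δ-off {a = c} (≢-sym v≢c))))
    (sym (cong₂ _+_ (bit-true (edge-sym G vw)) (δ-off {a = w} (≢-sym (edge⇒≢ G vw))))) z<s
  strict : ∀ d → closed w d < closed c d → Edge G c d × d ≢ w × ¬ Edge G w d
  strict d lt with w ≟ d | c ≟ d
  ... | yes refl | yes refl = contradiction refl w≢c
  ... | yes refl | no _     = contradiction lt (≤⇒≯ (≤-trans
        (subst (_≤ 1) (sym (+-identityʳ _)) (bit≤1 (adj G c d))) (m≤n+m 1 _)))
  ... | no _     | yes refl = contradiction lt (≤⇒≯ (subst₂ _≤_
        (cong (_+ 1) (sym (bit-false (loopless G c)))) (cong (_+ 0) (sym (bit-true wc))) ≤-refl))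
  ... | no w≢d   | no _     =
        let cd , ¬wd = bit-<⁻ (subst₂ _<_ (+-identityʳ _) (+-identityʳ _) lt)
        in cd , ≢-sym w≢d , ¬wd

-- The walk from w to c has a last edge yc. A neighbour d ≠ y of c is off the
-- walk; if the only candidate is d = y, a further neighbour d′ of c gives
-- either another candidate or a walk w d′ c that avoids the edge cd.
switch-partner : (G : Graph n) {v w c : Fin n} → ConnectedOff G v → Edge G v w → ¬ Edge G v c →
                 v ≢ c → degree G w ≤ degree G c → 2 ≤ degree G c →
                 ∃[ d ] (Edge G c d × d ≢ w × ¬ Edge G w d ×
                         Star (λ x z → Avoid G v x z × ¬ SamePair c d x z) w c)
switch-partner {n} G {v} {w} {c} off vw ¬vc v≢c w≤c 2≤c
  with private-neighbour G v≢c vw ¬vc w≤c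
     | first-arrival (off (≢-sym (edge⇒≢ G vw)) (≢-sym v≢c)) w≢c
  where
  w≢c : w ≢ c
  w≢c refl = ¬vc vw
... | d , cd , d≢w , ¬wd | y , s , yc , y≢c = choose
  where
  w≢c : w ≢ c
  w≢c refl = ¬vc vw
  via-y : ∀ {d} → d ≢ y → Star (λ x z → Avoid G v x z × ¬ SamePair c d x z) w c
  via-y d≢y = Star.map (λ (e , x≢c , z≢c) → e , samePair-missˡ x≢c z≢c) s
    ◅◅ (yc , λ { (inj₁ (y≡c , _)) → y≢c y≡c ; (inj₂ (y≡d , _)) → d≢y (sym y≡d) }) ◅ ε
  choose : ∃[ d ] (Edge G c d × d ≢ w × ¬ Edge G w d ×
                   Star (λ x z → Avoid G v x z × ¬ SamePair c d x z) w c)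
  choose with d ≟ y
  ... | no d≢y = d , cd , d≢w , ¬wd , via-y d≢y
  ... | yes refl with other-member (adj G c) d (subst (2 ≤_) (degree-sum G c) 2≤c)
  ...   | d′ , d′≢d , cd′ with d′ ≟ w | T? (adj G w d′)
  ...     | no d′≢w  | no ¬wd′ = d′ , cd′ , d′≢w , ¬wd′ , via-y d′≢d
  -- Here d′ is `w` itself, so wc is an edge and serves as the walk.
  ...     | yes refl | _ = d , cd , d≢w , ¬wd ,
            ((edge-sym G cd′ , ≢-sym (edge⇒≢ G vw) , ≢-sym v≢c)
              , λ { (inj₁ (w≡c , _)) → w≢c w≡c ; (inj₂ (w≡d , _)) → d≢w (sym w≡d) }) ◅ ε
  ...     | no d′≢w  | yes wd′ = d , cd , d≢w , ¬wd ,
            ((wd′ , ≢-sym (edge⇒≢ G vw) , d′≢v)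
              , λ { (inj₁ (w≡c , _)) → w≢c w≡c ; (inj₂ (w≡d , _)) → d≢w (sym w≡d) })
            ◅ ((edge-sym G cd′ , d′≢v , ≢-sym v≢c)
              , λ { (inj₁ (d′≡c , _)) → edge⇒≢ G cd′ (sym d′≡c) ; (inj₂ (d′≡d , _)) → d′≢d d′≡d })
            ◅ ε
    where
    d′≢v : d′ ≢ v
    d′≢v refl = ¬vc (edge-sym G cd′)

-- Off `v` the 2-switch trades the edge cd for wd. The walk from `w` to `c` that avoids cd survives,
-- and with wd it still joins `c` to `d`.
switch-neighbour : (G : Graph n) {v w c : Fin n} → ConnectedOff G v → Edge G v w → ¬ Edge G v c →
                   v ≢ c → degree G w ≤ degree G c → 2 ≤ degree G c →
                   ∃[ d ] ∃[ G′ ] (SwitchAt v w c d G G′ × ConnectedOff G′ v)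
switch-neighbour G {v} {w} {c} off vw ¬vc v≢c w≤c 2≤c
  with switch-partner G off vw ¬vc v≢c w≤c 2≤c
... | d , cd , d≢w , ¬wd , walk = d , G′ , S , λ x≢v y≢v → off x≢v y≢v Star.>>= reroute
  where
  v≢w : v ≢ w
  v≢w = edge⇒≢ G vw
  v≢d : v ≢ d
  v≢d refl = ¬vc (edge-sym G cd)
  w≢c : w ≢ c
  w≢c refl = ¬vc vw
  i : Interchangeable (matrix v w c d) G
  i = (vw , cd) , ((v≢c , v≢d) , (w≢c , ≢-sym d≢w)) , (¬vc , ¬wd)
  G′ = interchange (matrix v w c d) G i
  S : SwitchAt v w c d G G′
  S = interchange-switch G i
  keep : ∀ {x z} → Avoid G v x z → ¬ SamePair c d x z → Avoid G′ v x z
  keep (e , x≢v , z≢v) ¬cd = subst T (agree S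
      (samePair-missˡ x≢v z≢v)
      ¬cd
      (samePair-missˡ x≢v z≢v)
      (λ p → ¬wd (samePair-edge G p e))) e
    , x≢v , z≢v
  c→d : Star (Avoid G′ v) c d
  c→d = Star.reverse (avoid-sym G′) (Star.map (λ (e , ¬cd) → keep e ¬cd) walk)
    ◅◅ (proj₂ (proj₁ (added S)) , ≢-sym v≢w , ≢-sym v≢d) ◅ ε
  reroute : ∀ {x z} → Avoid G v x z → Star (Avoid G′ v) x z
  reroute {x} {z} e with samePair? c d x z
  ... | no ¬cd = keep e ¬cd ◅ ε
  ... | yes (inj₁ (refl , refl)) = c→d
  ... | yes (inj₂ (refl , refl)) = Star.reverse (avoid-sym G′) c→d

-- Sequences of 2-switches through connected graphs

infix 4 _⟶*_
-- Only connectedness of the later graphs is recorded; unicyclicity is recovered from it by counting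
-- edges when the sequence is carried out.
data _⟶*_ (G H : Graph n) : Set where
  done : G ≐ H → G ⟶* H
  step : ∀ {a b c d K} → SwitchAt a b c d G K → Connected K → K ⟶* H → G ⟶* H

-- For switches found on the side of the target: undone, they come at the end of the sequence.
snoc : {a b c d : Fin n} {G K H : Graph n} →
       G ⟶* K → SwitchAt a b c d K H → Connected H → G ⟶* H
snoc (done eq)       S conn = step (switch-respˡ (λ u v → sym (eq u v)) S) conn (done λ _ _ → refl)
snoc (step S′ c′ r) S conn = step S′ c′ (snoc r S conn)

-- Lifting 2-switches from G - v to G

connected-del⇒connectedOff : (G : Graph (suc n)) {v : Fin (suc n)} →
                             Connected (del v G) → ConnectedOff G v
connected-del⇒connectedOff G {v} conn x≢v y≢v = subst₂ (Star (Avoid G v))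
  (punchIn-punchOut (≢-sym x≢v)) (punchIn-punchOut (≢-sym y≢v))
  (Star.gmap (punchIn v) (λ e → e , punchInᵢ≢i v _ , punchInᵢ≢i v _)
    (conn (punchOut (≢-sym x≢v)) (punchOut (≢-sym y≢v))))

samePair-punchIn : (v : Fin (suc n)) {a b x y : Fin n} →
                   SamePair (punchIn v a) (punchIn v b) (punchIn v x) (punchIn v y) → SamePair a b x y
samePair-punchIn v (inj₁ (p , q)) = inj₁ (punchIn-injective v _ _ p , punchIn-injective v _ _ q)
samePair-punchIn v (inj₂ (p , q)) = inj₂ (punchIn-injective v _ _ p , punchIn-injective v _ _ q)

del-switch : (v : Fin (suc n)) {a b c d : Fin n} {G H : Graph (suc n)} →
             SwitchAt (punchIn v a) (punchIn v b) (punchIn v c) (punchIn v d) G H →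
             SwitchAt a b c d (del v G) (del v H)
del-switch v S = record
  { disjoint = let (a≢c , a≢d) , (b≢c , b≢d) = disjoint S in
               (a≢c ∘ cong (punchIn v) , a≢d ∘ cong (punchIn v)) ,
               (b≢c ∘ cong (punchIn v) , b≢d ∘ cong (punchIn v))
  ; removed  = removed S
  ; added    = added S
  ; agree    = λ p q r s → agree S (p ∘ samePair-punchIn v) (q ∘ samePair-punchIn v)
                                   (r ∘ samePair-punchIn v) (s ∘ samePair-punchIn v)
  }

agree-off-del : (v : Fin (suc n)) {G H : Graph (suc n)} → adj G v ≗ adj H v →
                del v G ≐ del v H → G ≐ H
agree-off-del v {G} {H} row eq x y with v ≟ x | v ≟ y
... | yes refl | _        = row y
... | no _     | yes refl = trans (adj-sym G x v) (trans (row x) (adj-sym H v x))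
... | no v≢x   | no v≢y   = subst₂ (λ x y → adj G x y ≡ adj H x y)
  (punchIn-punchOut v≢x) (punchIn-punchOut v≢y) (eq _ _)

-- A switch of G - v lifts to one of `G` that leaves the row of `v` alone, so `v` keeps its
-- neighbour `c` and the result is connected. `K` is separate from `del v G` because the two agree
-- only up to `≐` after a switch.
lift : (v : Fin (suc n)) {c : Fin (suc n)} {K : Graph n} (G H : Graph (suc n)) →
       Edge G v c → adj G v ≗ adj H v → del v G ≐ K → K ⟶* del v H → G ⟶* H
lift v G H vc row eq (done eq′) = done
  (agree-off-del v {G} {H} row λ x y → trans (eq x y) (eq′ x y))
lift v {c} G H vc row eq (step {a} {b} {c′} {d} {K} S conn r) =
  step S′ (connectedOff⇒connected G′ (connected-del⇒connectedOff G′ conn′) vc′)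
    (lift v G′ H vc′ (λ u → trans (sym (row′ u)) (row u)) eq′ r)
  where
  p = punchIn v
  S₀ : SwitchAt a b c′ d (del v G) K
  S₀ = switch-respˡ (λ x y → sym (eq x y)) S
  i : Interchangeable (matrix (p a) (p b) (p c′) (p d)) G
  i = let (a≢c , a≢d) , (b≢c , b≢d) = disjoint S₀ in
      proj₁ (removed S₀) ,
      ((a≢c ∘ punchIn-injective v _ _ , a≢d ∘ punchIn-injective v _ _) ,
       (b≢c ∘ punchIn-injective v _ _ , b≢d ∘ punchIn-injective v _ _)) ,
      proj₂ (added S₀)
  G′ = interchange (matrix (p a) (p b) (p c′) (p d)) G i
  S′ : SwitchAt (p a) (p b) (p c′) (p d) G G′
  S′ = interchange-switch G i
  eq′ : del v G′ ≐ K
  eq′ = switch-unique (del-switch v S′) S₀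
  conn′ : Connected (del v G′)
  conn′ x y = Star.map (λ {x} {y} → subst T (sym (eq′ x y))) (conn x y)
  -- No pair in the image of `punchIn v` contains `v`.
  fresh : ∀ {x y u} → ¬ SamePair (p x) (p y) v u
  fresh (inj₁ (v≡ , _)) = punchInᵢ≢i v _ (sym v≡)
  fresh (inj₂ (v≡ , _)) = punchInᵢ≢i v _ (sym v≡)
  row′ : adj G v ≗ adj G′ v
  row′ u = agree S′ fresh fresh fresh fresh
  vc′ : Edge G′ v c
  vc′ = subst T (row′ c) vc

-- The symmetric difference of two neighbourhoods, and its reduction by 2-switches

mismatch : Fin n → Graph n → Graph n → ℕ
mismatch v G H = sum (λ u → bit (adj G v u xor adj H v u))

mismatch-comm : (v : Fin n) (G H : Graph n) → mismatch v G H ≡ mismatch v H G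
mismatch-comm v G H = sum-cong-≗ λ u → cong bit (xor-comm (adj G v u) (adj H v u))

-- The row of `v` changes only at `w` and `c`, and there it now agrees with `H`; at `w` it disagreed
-- before.
mismatch-decreases : {v w c d : Fin n} {G G′ H : Graph n} → SwitchAt v w c d G G′ →
                     Edge H v c → ¬ Edge H v w → mismatch v G′ H < mismatch v G H
mismatch-decreases {n} {v} {w} {c} {d} {G} {G′} {H} S vc ¬vw = sum-strict w weakly strictly
  where
  v≢c = proj₁ (proj₁ (disjoint S))
  v≢d = proj₂ (proj₁ (disjoint S))
  v≢w = edge⇒≢ G (proj₁ (proj₁ (removed S)))
  same : ∀ {p q} → (T p → T q) → (T q → T p) → bit (p xor q) ≡ 0
  same {q = q} f g = cong bit (trans (cong (_xor q) (T-ext f g)) (xor-same q))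
  weakly : ∀ u → bit (adj G′ v u xor adj H v u) ≤ bit (adj G v u xor adj H v u)
  weakly u with u ≟ w | u ≟ c
  ... | yes refl | _ = subst (_≤ _)
    (sym (same (⊥-elim ∘ proj₁ (proj₂ (removed S))) (⊥-elim ∘ ¬vw))) z≤n
  ... | no _ | yes refl = subst (_≤ _) (sym (same (λ _ → vc) (λ _ → proj₁ (proj₁ (added S))))) z≤n
  ... | no u≢w | no u≢c = ≤-reflexive (cong (λ p → bit (p xor adj H v u)) (sym (agree S
    (λ { (inj₁ (_ , u≡w)) → u≢w u≡w ; (inj₂ (v≡w , _)) → v≢w v≡w })
    (λ { (inj₁ (v≡c , _)) → v≢c v≡c ; (inj₂ (v≡d , _)) → v≢d v≡d })
    (λ { (inj₁ (_ , u≡c)) → u≢c u≡c ; (inj₂ (v≡c , _)) → v≢c v≡c })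
    (λ { (inj₁ (v≡w , _)) → v≢w v≡w ; (inj₂ (v≡d , _)) → v≢d v≡d }))))
  differ : ∀ {p q} → T p → ¬ T q → bit (p xor q) ≡ 1
  differ {true} {true}  _ ¬q = ⊥-elim (¬q _)
  differ {true} {false} _ _  = refl
  strictly : bit (adj G′ v w xor adj H v w) < bit (adj G v w xor adj H v w)
  strictly = subst₂ _<_ (sym (same (⊥-elim ∘ proj₁ (proj₂ (removed S))) (⊥-elim ∘ ¬vw)))
                        (sym (differ (proj₁ (proj₁ (removed S))) ¬vw)) z<s

-- With equal degrees, a surplus on one side forces one on the other; the bits at `u` decide which
-- of them is `u` itself.
neighbourhoods-differ : (G H : Graph n) (v : Fin n) → degree G v ≡ degree H v →
  ∀ {u} → adj G v u ≢ adj H v u →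
  (∃[ w ] (Edge G v w × ¬ Edge H v w)) × (∃[ c ] (Edge H v c × ¬ Edge G v c))
neighbourhoods-differ G H v eq {u} ≢ with <-cmp (bit (adj G v u)) (bit (adj H v u))
... | tri≈ _ same _ = contradiction (bit-injective same) ≢
... | tri< lt _ _ = (_ , bit-<⁻ (proj₂ (sum-≤⇒∃< (bit ∘ adj H v) (bit ∘ adj G v) u
        (≤-reflexive (trans (sym (degree-sum H v)) (trans (sym eq) (degree-sum G v)))) lt)))
      , (u , bit-<⁻ lt)
... | tri> _ _ gt = (u , bit-<⁻ gt) , (_ , bit-<⁻ (proj₂ (sum-≤⇒∃< (bit ∘ adj G v) (bit ∘ adj H v) u
        (≤-reflexive (trans (sym (degree-sum G v)) (trans eq (degree-sum H v)))) gt)))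

-- Besides `v`, a neighbour of `c` is the first vertex after `c` on a walk from `c` to `w` in G - v.
two≤degree-off : (G : Graph n) {v c w : Fin n} → ConnectedOff G v → Edge G v c →
                 w ≢ v → c ≢ w → 2 ≤ degree G c
two≤degree-off G off vc w≢v c≢w with walk-first (off (≢-sym (edge⇒≢ G vc)) w≢v) c≢w
... | x , (cx , _ , x≢v) = two≤degree G (≢-sym x≢v) (edge-sym G vc) cx

-- `P` abstracts the invariants of the induction, and `aligned` is what remains once the
-- neighbourhoods of `v` agree.
module _ (v : Fin n) (P : Graph n → Set)
  (P-switch : ∀ {a b c d G K} → SwitchAt a b c d G K → P G → P K)
  (aligned : ∀ {G H} → ConnectedOff G v → ConnectedOff H v → P G →
             (∀ u → degree G u ≡ degree H u) → adj G v ≗ adj H v → G ⟶* H) where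

  align : ∀ k {G H} → mismatch v G H < k → ConnectedOff G v → ConnectedOff H v → P G →
          (∀ u → degree G u ≡ degree H u) → G ⟶* H
  align (suc k) {G} {H} (s≤s m≤k) offG offH PG deg
    with any? (λ u → ¬? (adj G v u ≟ᵇ adj H v u))
  ... | no none = aligned offG offH PG deg λ u →
        decidable-stable (adj G v u ≟ᵇ adj H v u) λ ne → none (u , ne)
  ... | yes (u , ne) with neighbourhoods-differ G H v (deg v) ne
  ...   | (w , vw , ¬vw) , (c , vc , ¬vc) with ≤-total (degree G w) (degree G c)
  ...     | inj₁ w≤c =
            let d , G′ , S , offG′ = switch-neighbour G offG vw ¬vc (edge⇒≢ H vc) w≤c
                  -- The degree of `c` is bounded in `H`, where vc is an edge, and carried over to
                  -- `G`.
                  (subst (2 ≤_) (sym (deg c))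
                    (two≤degree-off H offH vc (≢-sym (edge⇒≢ G vw)) λ { refl → ¬vc vw }))
            in step S (connectedOff⇒connected G′ offG′ (proj₁ (proj₁ (added S))))
                 (align k (<-≤-trans (mismatch-decreases {H = H} S vc ¬vw) m≤k)
                   offG′ offH (P-switch S PG)
                   λ x → trans (switch-degree S x) (deg x))
  ...     | inj₂ c≤w =
            -- The roles of the two graphs are exchanged: the switch is made in `H` and undone after
            -- the sequence from `G` to H′.
            let d , H′ , S , offH′ = switch-neighbour H offH vc ¬vw (edge⇒≢ G vw)
                  (subst₂ _≤_ (deg c) (deg w) c≤w)
                  (subst (2 ≤_) (deg w)
                    (two≤degree-off G offG vw (≢-sym (edge⇒≢ H vc)) λ { refl → ¬vc vw }))
            in snoc (align k (<-≤-trans (subst₂ _<_ (mismatch-comm v H′ G) (mismatch-comm v H G)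
                                          (mismatch-decreases {H = G} S vw ¬vc)) m≤k)
                       offG offH′ PG λ x → trans (deg x) (sym (switch-degree S x)))
                 (switch-sym S) (connectedOff⇒connected H offH vc)

-- Induction on the number of vertices

few-edges-del : (G : Graph (suc n)) (v : Fin (suc n)) → 1 ≤ degree G v →
                total G ≤ 2 * suc n → total (del v G) ≤ 2 * n
few-edges-del {n} G v 1≤d few = +-cancelˡ-≤ 2 _ _ (begin
  2 + total (del v G)              ≤⟨ +-monoˡ-≤ (total (del v G)) (*-monoʳ-≤ 2 1≤d) ⟩
  2 * degree G v + total (del v G) ≡⟨ total-del G v ⟨
  total G                          ≤⟨ few ⟩
  2 * suc n                        ≡⟨ *-suc 2 n ⟩
  2 + 2 * n                        ∎)
  where open ≤-Reasoning

-- The edge count is bounded rather than fixed so that G - v inherits the hypothesis: deleting a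
-- vertex of the cycle can leave a tree.
Transformable : ℕ → Set
Transformable n = (G H : Graph n) → Connected G → Connected H → total G ≤ 2 * n →
                  (∀ u → degree G u ≡ degree H u) → G ⟶* H

transform-step : Transformable (suc n) → Transformable (suc (suc n))
transform-step {n} ih G H connG connH few deg with noncut
  where
  noncut : ∃[ v ] (ConnectedOff G v × ConnectedOff H v)
  noncut with edges-dichotomy G connG few
  ... | inj₁ (v , leaf) = v , leaf-noncut G connG leaf
                            , leaf-noncut H connH (trans (sym (deg v)) leaf)
  ... | inj₂ regular    = zero , two-regular-noncut G connG regular zero
                               , two-regular-noncut H connH
                                   (λ u → trans (sym (deg u)) (regular u)) zero
... | v , offG , offH = align v P P-switch aligned _ ≤-refl offG offH (few , 1≤d) deg
  where
  -- The degree bound gives `lift` a neighbour of `v`; with the edge bound it makes `ih` applicable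
  -- to G - v.
  P : Graph (suc (suc n)) → Set
  P K = total K ≤ 2 * suc (suc n) × 1 ≤ degree K v
  1≤d : 1 ≤ degree G v
  1≤d = connected⇒one≤degree G connG v
  P-switch : ∀ {a b c d K L} → SwitchAt a b c d K L → P K → P L
  P-switch S (few , 1≤) = subst (_≤ 2 * suc (suc n)) (sym (sum-cong-≗ (switch-degree S))) few
                        , subst (1 ≤_) (sym (switch-degree S v)) 1≤
  aligned : ∀ {G H} → ConnectedOff G v → ConnectedOff H v → P G →
            (∀ u → degree G u ≡ degree H u) → adj G v ≗ adj H v → G ⟶* H
  aligned {G} {H} offG offH (few , 1≤) deg row = lift v G H
    (proj₂ (some-member (adj G v) (subst (1 ≤_) (degree-sum G v) 1≤))) row (λ _ _ → refl)
    (ih (del v G) (del v H)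
      (connectedOff⇒connected-del G offG) (connectedOff⇒connected-del H offH)
      (few-edges-del G v 1≤ few)
      λ i → +-cancelˡ-≡ (bit (adj G (punchIn v i) v)) _ _ (begin
        bit (adj G (punchIn v i) v) + degree (del v G) i ≡⟨ degree-del G v i ⟨
        degree G (punchIn v i)                           ≡⟨ deg (punchIn v i) ⟩
        degree H (punchIn v i)                           ≡⟨ degree-del H v i ⟩
        bit (adj H (punchIn v i) v) + degree (del v H) i
          ≡⟨ cong (λ p → bit p + degree (del v H) i)
               (trans (adj-sym H (punchIn v i) v)
                 (trans (sym (row (punchIn v i))) (adj-sym G v (punchIn v i)))) ⟩
        bit (adj G (punchIn v i) v) + degree (del v H) i ∎))
    where open ≡-Reasoning

transform : ∀ n → Transformable n
transform zero          G H connG connH few deg = done λ ()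
transform (suc zero)    G H connG connH few deg = done λ { zero zero →
  T-ext (⊥-elim ∘ loopless G zero) (⊥-elim ∘ loopless H zero) }
transform (suc (suc n)) = transform-step (transform (suc n))

-- Unicyclic graphs as the connected graphs with n edges

-- The list omits the first vertex, matching the division of a `Cycle` into `start` and `others`.
data Path (R : Rel (Fin n) 0ℓ) : Fin n → List (Fin n) → Fin n → Set where
  []  : ∀ {x} → Path R x [] x
  _∷_ : ∀ {x y ys z} → R x y → Path R y ys z → Path R x (y ∷ ys) z

path-end : {R : Rel (Fin n) 0ℓ} {x z : Fin n} {xs : List (Fin n)} → Path R x xs z → z ∈ x ∷ xs
path-end []      = here refl
path-end (_ ∷ p) = there (path-end p)

path-suffix : {R : Rel (Fin n) 0ℓ} {x y z : Fin n} {ys : List (Fin n)} →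
              Path R y ys z → Unique (y ∷ ys) → x ∈ y ∷ ys →
              ∃[ xs ] (Path R x xs z × Unique (x ∷ xs))
path-suffix p       u       (here refl) = _ , p , u
path-suffix (_ ∷ p) (_ ∷ u) (there x∈) = path-suffix p u x∈

-- Loop erasure: when `x` recurs on the simple path already obtained, restart from that occurrence.
simple-path : {R : Rel (Fin n) 0ℓ} {x z : Fin n} → Star R x z →
              ∃[ xs ] (Path R x xs z × Unique (x ∷ xs))
simple-path ε = [] , [] , [] ∷ []
simple-path {n} {x = x} (_◅_ {j = y} e s) with simple-path s
... | ys , p , u with DecMembership._∈?_ (_≟_ {n}) x (y ∷ ys)
...   | yes x∈ = path-suffix p u x∈
...   | no  x∉ = y ∷ ys , e ∷ p , ¬Any⇒All¬ _ x∉ ∷ u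

path-avoiding : {R : Rel (Fin n) 0ℓ} {u x z : Fin n} {xs : List (Fin n)} →
                Path R x xs z → All (u ≢_) (x ∷ xs) →
                Star (λ p q → R p q × p ≢ u × q ≢ u) x z
path-avoiding []      _                       = ε
path-avoiding (e ∷ p) (u≢x ∷ avoids@(u≢y ∷ _)) =
  (e , ≢-sym u≢x , ≢-sym u≢y) ◅ path-avoiding p avoids

closing-steps : {R S : Rel (Fin n) 0ℓ} {x z e : Fin n} {xs : List (Fin n)} →
                (∀ {p q} → R p q → S p q) → Path R x xs z → S z e →
                All (λ (p , q) → S p q) (zip (x ∷ xs) (xs ∷ʳ e))
closing-steps R⊆S []      last = last ∷ []
closing-steps R⊆S (r ∷ p) last = R⊆S r ∷ closing-steps R⊆S p last

closing-steps⁻ : {R : Rel (Fin n) 0ℓ} {x e : Fin n} (xs : List (Fin n)) →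
                 All (λ (p , q) → R p q) (zip (x ∷ xs) (xs ∷ʳ e)) → ∃[ z ] (Path R x xs z × R z e)
closing-steps⁻ []       (last ∷ []) = _ , [] , last
closing-steps⁻ (y ∷ ys) (r ∷ rs) =
  let z , p , last = closing-steps⁻ ys rs in z , r ∷ p , last

-- A simple path from `a` to `b` off `v` is closed up through `v`.
two-neighbours⇒cycle : (G : Graph n) {v a b : Fin n} → ConnectedOff G v → a ≢ b →
                       Edge G v a → Edge G v b → Cycle G
two-neighbours⇒cycle G {v} {a} {b} off a≢b va vb
  with simple-path (off (≢-sym (edge⇒≢ G va)) (≢-sym (edge⇒≢ G vb)))
... | xs , p , u = record
  { start    = v
  ; others   = a ∷ xs
  ; long     = long p
  ; distinct = avoids (edge⇒≢ G va) p ∷ u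
  ; adjacent = va ∷ closing-steps proj₁ p (edge-sym G vb)
  }
  where
  long : ∀ {xs} → Path (Avoid G v) a xs b → 3 ≤ length (v ∷ a ∷ xs)
  long []      = contradiction refl a≢b
  long (_ ∷ _) = s≤s (s≤s (s≤s z≤n))
  avoids : ∀ {x xs z} → v ≢ x → Path (Avoid G v) x xs z → All (v ≢_) (x ∷ xs)
  avoids v≢x []                    = v≢x ∷ []
  avoids v≢x ((_ , _ , y≢v) ∷ p) = v≢x ∷ avoids (≢-sym y≢v) p

cycle-del⇒cycle : (G : Graph (suc n)) (v : Fin (suc n)) → Cycle (del v G) → Cycle G
cycle-del⇒cycle {n} G v C = record
  { start    = p start
  ; others   = List.map p others
  ; long     = subst (λ k → 3 ≤ suc k) (sym (length-map p others)) long
  ; distinct = map⁺ (punchIn-injective v _ _) distinct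
  ; adjacent = subst (λ ys → All (λ (x , y) → Edge G x y) (zip (List.map p (start ∷ others)) ys))
      (map-++ p others (start ∷ [])) (zip-map (start ∷ others) (others ∷ʳ start) adjacent)
  }
  where
  open Cycle C
  p : Fin n → Fin (suc n)
  p = punchIn v
  zip-map : ∀ xs ys → All (λ (x , y) → Edge G (p x) (p y)) (zip xs ys) →
            All (λ (x , y) → Edge G x y) (zip (List.map p xs) (List.map p ys))
  zip-map []       _        _        = []
  zip-map (_ ∷ _)  []       _        = []
  zip-map (_ ∷ xs) (_ ∷ ys) (e ∷ es) = e ∷ zip-map xs ys es

-- Deleting a non-cut vertex loses at least one edge and leaves a connected graph for the induction.
connected⇒2n≤total : ∀ n (G : Graph (suc n)) → Connected G → 2 * n ≤ total G
connected⇒2n≤total zero    G conn = z≤n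
connected⇒2n≤total (suc n) G conn with exists-noncut G conn
... | v , off = begin
  2 * suc n                        ≡⟨ *-suc 2 n ⟩
  2 + 2 * n                        ≤⟨ +-mono-≤ (*-monoʳ-≤ 2 (connected⇒one≤degree G conn v))
                                       (connected⇒2n≤total n (del v G) (connectedOff⇒connected-del G off)) ⟩
  2 * degree G v + total (del v G) ≡⟨ total-del G v ⟨
  total G                          ∎
  where open ≤-Reasoning

-- Delete a non-cut vertex `v`. If the rest has no cycle, either `v` has degree at most 1 and the
-- bound carries over, or two neighbours of `v` are joined in G - v and yield a cycle.
total≤2n⊎cycle : ∀ n (G : Graph (suc n)) → Connected G → total G ≤ 2 * n ⊎ Cycle G
total≤2n⊎cycle zero    G conn = inj₁ (≤-reflexive (trans (total-del G zero)
  (trans (+-identityʳ _) (cong (2 *_) (trans (degree-sum G zero)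
    (trans (+-identityʳ _) (bit-false (loopless G zero))))))))
total≤2n⊎cycle (suc n) G conn with exists-noncut G conn
... | v , off with total≤2n⊎cycle n (del v G) (connectedOff⇒connected-del G off)
...   | inj₂ C = inj₂ (cycle-del⇒cycle G v C)
...   | inj₁ few with degree G v ≤? 1
...     | yes d≤1 = inj₁ (begin
          total G                          ≡⟨ total-del G v ⟩
          2 * degree G v + total (del v G) ≤⟨ +-mono-≤ (*-monoʳ-≤ 2 d≤1) few ⟩
          2 + 2 * n                        ≡⟨ *-suc 2 n ⟨
          2 * suc n                        ∎)
  where open ≤-Reasoning
...     | no  d≰1 =
          let 2≤       = subst (2 ≤_) (degree-sum G v) (≰⇒> d≰1)
              a , va   = some-member (adj G v) (≤-trans (s≤s z≤n) 2≤)
              b , b≢a , vb = other-member (adj G v) a 2≤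
          in inj₂ (two-neighbours⇒cycle G off (≢-sym b≢a) va vb)

-- Edges on a cycle are not bridges

steps : {G : Graph n} → Cycle G → List (Fin n × Fin n)
steps C = cyclicSteps (Cycle.start C) (Cycle.others C)

first-step : {G : Graph n} (C : Cycle G) → ∃[ a ] ∃[ b ] ((a , b) ∈ steps C)
first-step record { start = v ; others = w ∷ _ } = v , w , here refl
first-step record { others = [] ; long = s≤s () }

-- A step ab of the closed path x … z e is its last one, or splits x … z into
-- x … a, which misses b, and b … z, which misses a.
split-at-step : {R : Rel (Fin n) 0ℓ} {x z e a b : Fin n} {xs : List (Fin n)} →
                Path R x xs z → Unique (x ∷ xs) → (a , b) ∈ zip (x ∷ xs) (xs ∷ʳ e) →
                (a ≡ z × b ≡ e) ⊎
                (Star (λ p q → R p q × p ≢ b × q ≢ b) x a ×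
                 Star (λ p q → R p q × p ≢ a × q ≢ a) b z ×
                 a ∈ x ∷ xs × b ∈ xs × (x ≡ a → z ≡ b → length xs ≡ 1))
split-at-step []      _ (here refl) = inj₁ (refl , refl)
split-at-step (_ ∷ p) (x∉ ∷ u) (here refl) =
  -- If the step also ends at `z`, the rest is a simple path from `z` to `z`, hence empty.
  inj₂ (ε , path-avoiding p x∉ , here refl , here refl , λ { _ refl → cong suc (trivial p u) })
  where
  trivial : ∀ {R y ys} → Path R y ys y → Unique (y ∷ ys) → length ys ≡ 0
  trivial []      _        = refl
  trivial (_ ∷ p) (y∉ ∷ _) = contradiction refl (All.lookup y∉ (path-end p))
split-at-step (e ∷ p) (x∉@(_ ∷ x∉ys) ∷ u@(y∉ ∷ _)) (there i) with split-at-step p u i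
... | inj₁ last = inj₁ last
... | inj₂ (s , t , a∈ , b∈ , _) = inj₂
  ( (e , All.lookup x∉ys b∈ , All.lookup y∉ b∈) ◅ s , t , there a∈ , there b∈
  , λ { refl _ → contradiction refl (All.lookup x∉ a∈) })

-- Go round the rest of the cycle: for the closing step this is the whole path; otherwise go from
-- `a` back to `v`, over the closing step to `z`, and back to `b`.
cycle-detour : (G : Graph n) (C : Cycle G) {a b : Fin n} → (a , b) ∈ steps C →
               Star (Edge (deleteEdge G a b)) a b
cycle-detour G record { start = v ; others = vs ; long = long ; distinct = distinct
                     ; adjacent = adjacent } {a} {b} i
  with closing-steps⁻ vs adjacent
... | z , p , zv with split-at-step p distinct i
...   | inj₁ (refl , refl) = Star.reverse (edge-sym (deleteEdge G z v)) (around p distinct long)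
  where
  around : ∀ {vs} → Path (Edge G) v vs z → Unique (v ∷ vs) → 3 ≤ length (v ∷ vs) →
           Star (Edge (deleteEdge G z v)) v z
  around []       _ (s≤s ())
  around (_ ∷ []) _ (s≤s (s≤s ()))
  -- Only the first edge meets `v`; it is not zv, since the simple path goes on from its other end
  -- to reach `z` later.
  around (e ∷ e′ ∷ p) (v∉@(v≢y ∷ _) ∷ (y∉ ∷ _)) _ =
    deleteEdge⁺ G e (λ { (inj₁ (_ , y≡v)) → v≢y (sym y≡v)
                       ; (inj₂ (_ , y≡z)) → All.lookup y∉ (path-end p) y≡z })
      ◅ Star.map (λ (f , p≢v , q≢v) → deleteEdge⁺ G f (samePair-missʳ p≢v q≢v))
          (path-avoiding (e′ ∷ p) v∉)
...   | inj₂ (s , t , a∈ , b∈ , short) =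
  Star.reverse (edge-sym G′) (Star.map (λ (f , p≢b , q≢b) → deleteEdge⁺ G f (samePair-missʳ p≢b q≢b)) s)
  ◅◅ edge-sym G′ (deleteEdge⁺ G zv closing)
  ◅ Star.reverse (edge-sym G′) (Star.map (λ (f , p≢a , q≢a) → deleteEdge⁺ G f (samePair-missˡ p≢a q≢a)) t)
  where
  G′ = deleteEdge G a b
  v∉ : Unique (v ∷ vs) → All (v ≢_) vs
  v∉ (v∉ ∷ _) = v∉
  -- Were the closing step ab reversed, the cycle would have just two vertices.
  closing : ¬ SamePair a b z v
  closing (inj₁ (_ , v≡b))   = All.lookup (v∉ distinct) b∈ v≡b
  closing (inj₂ (z≡b , v≡a)) =
    contradiction (subst (λ k → 3 ≤ suc k) (short v≡a z≡b) long) λ { (s≤s (s≤s ())) }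

cycle-edge-not-bridge : (G : Graph n) → Connected G → (C : Cycle G) {a b : Fin n} →
                        (a , b) ∈ steps C → Connected (deleteEdge G a b)
cycle-edge-not-bridge G conn C {a} {b} i x y = conn x y Star.>>= reroute
  where
  reroute : ∀ {x y} → Edge G x y → Star (Edge (deleteEdge G a b)) x y
  reroute {x} {y} e with samePair? a b x y
  ... | no ¬ab                   = deleteEdge⁺ G e ¬ab ◅ ε
  ... | yes (inj₁ (refl , refl)) = cycle-detour G C i
  ... | yes (inj₂ (refl , refl)) = Star.reverse (edge-sym (deleteEdge G a b)) (cycle-detour G C i)

step-edge : {G : Graph n} (C : Cycle G) {a b : Fin n} → (a , b) ∈ steps C → Edge G a b
step-edge C = All.lookup (Cycle.adjacent C)

cycle-deleteEdge⁻ : (G : Graph n) {a b : Fin n} → Cycle (deleteEdge G a b) → Cycle G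
cycle-deleteEdge⁻ G C = record
  { start = start ; others = others ; long = long ; distinct = distinct
  ; adjacent = All.map (proj₁ ∘ deleteEdge⁻ G) adjacent
  } where open Cycle C

cycle-deleteEdge⁺ : (G : Graph n) {a b : Fin n} (C : Cycle G) → ¬ CycleEdge C a b →
                    Cycle (deleteEdge G a b)
cycle-deleteEdge⁺ G {a} {b} C ¬ab = record
  { start = start ; others = others ; long = long ; distinct = distinct
  ; adjacent = All.tabulate λ i → deleteEdge⁺ G (step-edge C i)
      λ { (inj₁ (refl , refl)) → ¬ab (inj₁ i) ; (inj₂ (refl , refl)) → ¬ab (inj₂ i) }
  } where open Cycle C

-- Delete an edge ab of the cycle. The graph stays connected, and a cycle left in it would be one of
-- `G`, hence have the edges of `C`, including ab. So a tree remains, whose edges are counted by the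
-- two preceding bounds.
unicyclic⇒total : (G : Graph n) → Unicyclic G → total G ≡ 2 * n
unicyclic⇒total {zero}  G _ = refl
unicyclic⇒total {suc n} G (conn , C , only) with first-step C
... | a , b , i = begin
  total G                      ≡⟨ total-deleteEdge G (step-edge C i) ⟩
  total (deleteEdge G a b) + 2 ≡⟨ cong (_+ 2) (≤-antisym upper lower) ⟩
  2 * n + 2                    ≡⟨ +-comm (2 * n) 2 ⟩
  2 + 2 * n                    ≡⟨ *-suc 2 n ⟨
  2 * suc n                    ∎
  where
  open ≡-Reasoning
  conn′ : Connected (deleteEdge G a b)
  conn′ = cycle-edge-not-bridge G conn C i
  lower : 2 * n ≤ total (deleteEdge G a b)
  lower = connected⇒2n≤total n (deleteEdge G a b) conn′
  upper : total (deleteEdge G a b) ≤ 2 * n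
  upper with total≤2n⊎cycle n (deleteEdge G a b) conn′
  ... | inj₁ few = few
  ... | inj₂ D with Equivalence.to (only (cycle-deleteEdge⁻ G D) a b) (inj₁ i)
  ...   | inj₁ j = contradiction (inj₁ (refl , refl))
            (proj₂ (deleteEdge⁻ G {a} {b} (step-edge D j)))
  ...   | inj₂ j = contradiction (inj₂ (refl , refl))
            (proj₂ (deleteEdge⁻ G {a} {b} (step-edge D j)))

cycleEdge-sym : {G : Graph n} (C : Cycle G) {u v : Fin n} → CycleEdge C u v → CycleEdge C v u
cycleEdge-sym C (inj₁ i) = inj₂ i
cycleEdge-sym C (inj₂ i) = inj₁ i

-- Otherwise an edge of C and an edge of D could be deleted in turn, leaving a
-- connected graph on n + 1 vertices with n − 1 edges.
step⇒cycleEdge : (G : Graph (suc n)) → Connected G → total G ≡ 2 * suc n →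
                 (C D : Cycle G) {a b : Fin (suc n)} → (a , b) ∈ steps C → CycleEdge D a b
step⇒cycleEdge {n} G conn eq C D {a} {b} i
  with ((a , b) ∈? steps D) ⊎-dec ((b , a) ∈? steps D)
  where open DecMembership (≡-dec (_≟_ {suc n}) (_≟_ {suc n})) using (_∈?_)
... | yes ab = ab
... | no ¬ab with first-step (cycle-deleteEdge⁺ G D ¬ab)
...   | x , y , j = contradiction (connected⇒2n≤total n G″ conn″) (<⇒≱ (begin-strict
  total G″     <⟨ m<m+n (total G″) z<s ⟩
  total G″ + 2 ≡⟨ +-cancelˡ-≡ 2 _ _ (begin-equality
    2 + (total G″ + 2) ≡⟨ cong (2 +_) (total-deleteEdge G′ (step-edge D′ j)) ⟨
    2 + total G′       ≡⟨ +-comm 2 (total G′) ⟩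
    total G′ + 2       ≡⟨ total-deleteEdge G (step-edge C i) ⟨
    total G            ≡⟨ eq ⟩
    2 * suc n          ≡⟨ *-suc 2 n ⟩
    2 + 2 * n          ∎) ⟩
  2 * n        ∎))
  where
  open ≤-Reasoning
  G′ = deleteEdge G a b
  D′ : Cycle G′
  D′ = cycle-deleteEdge⁺ G D ¬ab
  G″ = deleteEdge G′ x y
  conn″ : Connected G″
  conn″ = cycle-edge-not-bridge G′ (cycle-edge-not-bridge G conn C i) D′ j

-- There are too many edges for an acyclic graph, and any two cycles contain each other's edges by
-- `step⇒cycleEdge`.
total⇒unicyclic : (G : Graph (suc n)) → Connected G → total G ≡ 2 * suc n → Unicyclic G
total⇒unicyclic {n} G conn eq with total≤2n⊎cycle n G conn
... | inj₁ few = contradiction few (<⇒≱ (subst (2 * n <_) (sym eq) (*-monoʳ-< 2 (n<1+n n))))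
... | inj₂ C   = conn , C , λ D u v → mk⇔ (included C D) (included D C)
  where
  included : ∀ C D {u v} → CycleEdge C u v → CycleEdge D u v
  included C D (inj₁ i) = step⇒cycleEdge G conn eq C D i
  included C D (inj₂ i) = cycleEdge-sym D (step⇒cycleEdge G conn eq C D i)

-- From graph relations to switch sequences

τ-switch : {a b c d : Fin n} {G K : Graph n} → SwitchAt a b c d G K → τ (matrix a b c d) G ≐ K
τ-switch {a = a} {b} {c} {d} {G} S with interchangeable? (matrix a b c d) G
... | yes i = switch-unique (interchange-switch G i) S
... | no ¬i = contradiction (switch-interchangeable S) ¬i

connected-resp : {G H : Graph n} → G ≐ H → Connected G → Connected H
connected-resp eq conn x y = Star.map (λ {x} {y} → subst T (eq x y)) (conn x y)

scanl-∷ : {A B : Set} (f : A → B → A) (e : A) (x : B) (xs : List B) →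
          scanl f e (x ∷ xs) ≡ e ∷ scanl f (f e x) xs
scanl-∷ f e x xs = trans (scanl-defn f e (x ∷ xs))
  (cong (e ∷_) (trans (sym (map-∘ (List.inits xs))) (sym (scanl-defn f (f e x) xs))))

-- The sequence is replayed from `U`, equal to `G` only up to `≐`, since `τ` builds graphs of its
-- own. Each result is connected with unchanged degrees, hence has as many edges as vertices.
realise : (s : Vec ℕ n) {G H : Graph n} → G ⟶* H → (U : Graph n) → U ≐ G → 𝒰 s U →
          ∃[ As ] (USwitchSequence As U × result As U ≈ H × All (𝒰 s) (trajectory As U))
realise s {H = H} (done eq′) U eq U∈ =
  [] , _ , ≐⇒≈ {G = U} {H} (λ x y → trans (eq x y) (eq′ x y)) , U∈ ∷ []
-- Without vertices there is no switch; the next clause needs a successor for `total⇒unicyclic`.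
realise {zero} s (step {()} _ _ _)
realise {suc n} s (step {a} {b} {c} {d} {K} S conn r) U eq U∈@(uni , seq) =
  let As , switches , end , all = realise s r (τ A U) τ≐K (uni′ , seq′)
  in A ∷ As , ((uni , switch-interchangeable S′ , uni′) , switches) , end
   , subst (All (𝒰 s)) (sym (scanl-∷ (λ G A → τ A G) U A As)) (U∈ ∷ all)
  where
  A = matrix a b c d
  S′ : SwitchAt a b c d U K
  S′ = switch-respˡ (λ x y → sym (eq x y)) S
  τ≐K : τ A U ≐ K
  τ≐K = τ-switch S′
  degrees : ∀ u → degree (τ A U) u ≡ degree U u
  degrees = switch-degree (switch-respʳ {H = K} {τ A U} (λ x y → sym (τ≐K x y)) S′)
  uni′ : Unicyclic (τ A U)
  uni′ = total⇒unicyclic (τ A U) (connected-resp {G = K} {τ A U} (λ x y → sym (τ≐K x y)) conn)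
           (trans (sum-cong-≗ degrees) (unicyclic⇒total U uni))
  seq′ : degreeSequence (τ A U) ≡ s
  seq′ = trans (tabulate-cong degrees) seq

degreeSequence-injective : (G H : Graph n) → degreeSequence G ≡ degreeSequence H →
                           ∀ u → degree G u ≡ degree H u
degreeSequence-injective G H eq u = trans (sym (lookup∘tabulate (degree G) u))
  (trans (cong (λ s → Vec.lookup s u) eq) (lookup∘tabulate (degree H) u))

theorem3p9 : ∀ (n : ℕ) (s : Vec ℕ n) (U U′ : Graph n) → 𝒰 s U → 𝒰 s U′ →
    ∃[ As ] (USwitchSequence As U × result As U ≈ U′ × All (𝒰 s) (trajectory As U))
theorem3p9 n s U U′ (uni , seq) (uni′ , seq′) = realise s
  (transform n U U′ (proj₁ uni) (proj₁ uni′) (≤-reflexive (unicyclic⇒total U uni))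
    (degreeSequence-injective U U′ (trans seq (sym seq′))))
  U (λ _ _ → refl) (uni , seq)
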